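{- Let $a\in\{1,2\}$ and let $n,k$ be positive integers with $k\le a3^n$. Then $v_3\big(s(a3^n+1,k+1)\big)=v_3\big(s(a3^n,k)\big)$ if $2\mid (k-a)$, and $v_3\big(s(a3^n+1,k+1)\big)\ge v_3\big(s(a3^n,k+1)\big)+n$ if $2\nmid (k-a)$.
   Context: $s(N,K)$ denotes the unsigned Stirling number of the first kind (the number of permutations of $N$ elements with exactly $K$ disjoint cycles). For a nonzero integer $x$, $v_3(x)$ is the exponent of the largest power of $3$ dividing $x$. -}

module Defs where

open import Data.Nat using (ℕ; zero; suc; _+_; _*_; _^_)
open import Data.Nat.Divisibility using (_∣_)
open import Data.Product using (_×_)
open import Relation.Nullary using (¬_)

stirling₁ : ℕ → ℕ → ℕ
stirling₁ zero    zero    = 1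
stirling₁ zero    (suc k) = 0
stirling₁ (suc n) zero    = 0
stirling₁ (suc n) (suc k) = n * stirling₁ n (suc k) + stirling₁ n k

-- "v₃(x) = e" : 3^e divides x but 3^(e+1) does not.
-- For nonzero x there is exactly one such e; for x = 0 there is none.
V3 : ℕ → ℕ → Set
V3 x e = (3 ^ e ∣ x) × ¬ (3 ^ suc e ∣ x)

{-# OPTIONS --safe #-}

-- Write N = a 3ⁿ and t = x (x + N).  Pairing i with N - i in the rising factorial
-- x (x + 1) ⋯ (x + N - 1) gives x (x + 3ⁿ)^(a-1) Σ e_k t^(h-k), where the e_k are the
-- elementary symmetric functions of the numbers i (N - i).  Expanding t^(h-k), and
-- writing κ = N - k, the claim follows from v₃(e_{j+1}) < v₃(e_j) + 2 n : then s(N, k)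
-- has the valuation of e_j if κ = 2 j, and at least that of 3ⁿ e_j if κ = 2 j + 1.
--
-- The inequality is proved by induction on n.  The multiples of 3 among the i contribute
-- the polynomial for n - 1 with e_k replaced by 9^k e_k.  The other i contribute
-- W(y) = Π (1 + i (N - i) y), with i ≡ 1 (mod 3) and m = a 3^(n-1) factors, and
-- W ≡ (1 + 2 y)^m (mod 3ⁿ).  Hence v₃(k W_k) = n - 1 for 0 < k ≤ m, which makes one term
-- of each convolution dominate the others: v₃(e_k) < n for k ≤ m, and beyond m the e's
-- have the valuations of the previous ones.
module Submission where

open import Defs
open import Algebra.Bundles using (CommutativeMonoid; CommutativeSemiring)
import Algebra.Construct.Pointwise as Pointwise
import Algebra.Solver.Ring.NaturalCoefficients.Default as SemiringSolver
open import Algebra.Properties.CommutativeSemigroup using (x∙yz≈y∙xz; interchange)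
open import Algebra.Structures.Biased using (isCommutativeSemiringˡ)
import Data.Integer as ℤ
import Data.Integer.Properties as ℤ
open import Data.Nat using (ℕ; zero; suc; _+_; _*_; _^_; _∸_; _≤_; _<_; _≥_; z≤n; s≤s; NonZero; >-nonZero)
open import Data.Nat.Divisibility renaming (_∣_ to _∣ℕ_)
open import Data.Nat.Primality using (prime?; euclidsLemma)
open import Data.Nat.Properties
open import Data.Nat.Tactic.RingSolver using (solve-∀)
open import Data.Product using (_×_; _,_; proj₁; proj₂; ∃)
open import Data.Sum using (_⊎_; inj₁; inj₂; [_,_]′)
open import Function using (_∘_; const)
open import Level using (0ℓ)
open import Relation.Binary.Definitions using (tri<; tri≈; tri>)
open import Relation.Binary.PropositionalEquality
  using (_≡_; _≢_; _≗_; refl; sym; trans; cong; cong₂; subst; module ≡-Reasoning)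
import Relation.Binary.Reasoning.Setoid as SetoidReasoning
open import Relation.Nullary using (¬_; yes; no; contradiction)
open import Relation.Nullary.Decidable using (from-yes)

-- Power series

-- Formal power series over ℕ; f k is the coefficient of y ^ k.
Series : Set
Series = ℕ → ℕ

infixl 7 _⊛_
infixl 6 _⊕_

_⊕_ : Series → Series → Series
(f ⊕ g) k = f k + g k

_⊛_ : Series → Series → Series
(f ⊛ g) zero    = f 0 * g 0
(f ⊛ g) (suc k) = f 0 * g (suc k) + ((f ∘ suc) ⊛ g) k

scalar : ℕ → Series
scalar c zero    = c
scalar c (suc k) = 0

-- The polynomial 1 + w y, which is x + w reversed by x = 1 / y.
lin : ℕ → Series
lin w zero    = 1
lin w (suc k) = scalar w k

⊛-cong : ∀ {f f′ g g′} → f ≗ f′ → g ≗ g′ → f ⊛ g ≗ f′ ⊛ g′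
⊛-cong p q zero    = cong₂ _*_ (p 0) (q 0)
⊛-cong p q (suc k) = cong₂ _+_ (cong₂ _*_ (p 0) (q (suc k))) (⊛-cong (p ∘ suc) q k)

⊛-zeroˡ : ∀ g → const 0 ⊛ g ≗ const 0
⊛-zeroˡ g zero    = refl
⊛-zeroˡ g (suc k) = ⊛-zeroˡ g k

⊛-distribʳ : ∀ h f g → (f ⊕ g) ⊛ h ≗ (f ⊛ h) ⊕ (g ⊛ h)
⊛-distribʳ h f g zero    = *-distribʳ-+ (h 0) (f 0) (g 0)
⊛-distribʳ h f g (suc k) = trans
  (cong₂ _+_ (*-distribʳ-+ (h (suc k)) (f 0) (g 0)) (⊛-distribʳ h (f ∘ suc) (g ∘ suc) k))
  (interchange +-commutativeSemigroup (f 0 * h (suc k)) _ _ _)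

*-⊛ : ∀ c f g → (λ k → c * f k) ⊛ g ≗ (λ k → c * (f ⊛ g) k)
*-⊛ c f g zero    = *-assoc c (f 0) (g 0)
*-⊛ c f g (suc k) = trans
  (cong₂ _+_ (*-assoc c (f 0) (g (suc k))) (*-⊛ c (f ∘ suc) g k))
  (sym (*-distribˡ-+ c (f 0 * g (suc k)) _))

⊛-assoc : ∀ f g h → (f ⊛ g) ⊛ h ≗ f ⊛ (g ⊛ h)
⊛-assoc f g h zero    = *-assoc (f 0) (g 0) (h 0)
⊛-assoc f g h (suc k) = begin
  f 0 * g 0 * h (suc k) + (((f ⊛ g) ∘ suc) ⊛ h) k
    ≡⟨ cong (f 0 * g 0 * h (suc k) +_) (⊛-distribʳ h (λ i → f 0 * g (suc i)) ((f ∘ suc) ⊛ g) k) ⟩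
  f 0 * g 0 * h (suc k) + (((λ i → f 0 * g (suc i)) ⊛ h) k + (((f ∘ suc) ⊛ g) ⊛ h) k)
    ≡⟨ cong₂ (λ a b → f 0 * g 0 * h (suc k) + (a + b)) (*-⊛ (f 0) (g ∘ suc) h k) (⊛-assoc (f ∘ suc) g h k) ⟩
  f 0 * g 0 * h (suc k) + (f 0 * ((g ∘ suc) ⊛ h) k + ((f ∘ suc) ⊛ (g ⊛ h)) k)
    ≡⟨ factor (f 0) (g 0) (h (suc k)) _ _ ⟩
  f 0 * (g 0 * h (suc k) + ((g ∘ suc) ⊛ h) k) + ((f ∘ suc) ⊛ (g ⊛ h)) k ∎
  where
  open ≡-Reasoning
  factor : ∀ a b c d e → a * b * c + (a * d + e) ≡ a * (b * c + d) + e
  factor = solve-∀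

-- `_⊛_` recurses on its left factor; this mirror recursion turns commutativity into an induction.
⊛-sucʳ : ∀ f g k → (f ⊛ g) (suc k) ≡ f (suc k) * g 0 + (f ⊛ (g ∘ suc)) k
⊛-sucʳ f g zero    = +-comm (f 0 * g 1) (f 1 * g 0)
⊛-sucʳ f g (suc k) = trans (cong (f 0 * g (suc (suc k)) +_) (⊛-sucʳ (f ∘ suc) g k))
  (x∙yz≈y∙xz +-commutativeSemigroup (f 0 * g (suc (suc k))) (f (suc (suc k)) * g 0) _)

⊛-comm : ∀ f g → f ⊛ g ≗ g ⊛ f
⊛-comm f g zero    = *-comm (f 0) (g 0)
⊛-comm f g (suc k) = trans (cong₂ _+_ (*-comm (f 0) (g (suc k))) (⊛-comm (f ∘ suc) g k))
  (sym (⊛-sucʳ g f k))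

scalar-⊛ : ∀ c f k → (scalar c ⊛ f) k ≡ c * f k
scalar-⊛ c f zero    = refl
scalar-⊛ c f (suc k) = trans (cong (c * f (suc k) +_) (⊛-zeroˡ f k)) (+-identityʳ _)

⊛-identityˡ : ∀ f → scalar 1 ⊛ f ≗ f
⊛-identityˡ f k = trans (scalar-⊛ 1 f k) (*-identityˡ (f k))

series : CommutativeSemiring 0ℓ 0ℓ
series = record
  { Carrier = Series ; _≈_ = _≗_ ; _+_ = _⊕_ ; _*_ = _⊛_ ; 0# = const 0 ; 1# = scalar 1
  ; isCommutativeSemiring = isCommutativeSemiringˡ record
    { +-isCommutativeMonoid = Pointwise.isCommutativeMonoid ℕ +-0-isCommutativeMonoid
    ; *-isCommutativeMonoid = record
      { isMonoid = record
        { isSemigroup = record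
          { isMagma = record
            { isEquivalence = CommutativeMonoid.isEquivalence +-pointwise
            ; ∙-cong = ⊛-cong }
          ; assoc = ⊛-assoc }
        ; identity = ⊛-identityˡ , λ f k → trans (⊛-comm f (scalar 1) k) (⊛-identityˡ f k) }
      ; comm = ⊛-comm }
    ; distribʳ = ⊛-distribʳ
    ; zeroˡ = ⊛-zeroˡ } }
  where
  +-pointwise = Pointwise.commutativeMonoid ℕ +-0-commutativeMonoid

open CommutativeSemiring series public using ()
  renaming (setoid to ≗-setoid; +-cong to ⊕-cong; refl to ≗-refl; sym to ≗-sym; trans to ≗-trans; *-identityʳ to ⊛-identityʳ)

-- Finite products and congruences

module Products {c ℓ} (R : CommutativeSemiring c ℓ) where
  open CommutativeSemiring R
    using (Carrier; _≈_; setoid; 0#; 1#)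
    renaming (_+_ to _⊞_; _*_ to _⊠_; refl to ≈-refl; sym to ≈-sym; trans to ≈-trans;
              reflexive to ≈-reflexive; +-cong to ⊞-cong; *-cong to ⊠-cong;
              zeroʳ to ⊠-zeroʳ; +-identityʳ to ⊞-identityʳ; *-identityʳ to ⊠-identityʳ)
  open SemiringSolver R using (solve; _:=_; _:+_; _:*_; con)
  open SetoidReasoning setoid

  Π : (ℕ → Carrier) → ℕ → Carrier
  Π f zero    = 1#
  Π f (suc m) = Π f m ⊠ f m

  Π-cong : ∀ {f g} m → (∀ z → z < m → f z ≈ g z) → Π f m ≈ Π g m
  Π-cong zero    f≈g = ≈-refl
  Π-cong (suc m) f≈g = ⊠-cong (Π-cong m λ z z<m → f≈g z (m<n⇒m<1+n z<m)) (f≈g m ≤-refl)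

  Π-+ : ∀ f m n → Π f (m + n) ≈ Π f m ⊠ Π (λ z → f (m + z)) n
  Π-+ f m zero    = ≈-trans (≈-reflexive (cong (Π f) (+-identityʳ m))) (≈-sym (⊠-identityʳ _))
  Π-+ f m (suc n) = begin
    Π f (m + suc n)                                   ≡⟨ cong (Π f) (+-suc m n) ⟩
    Π f (m + n) ⊠ f (m + n)                           ≈⟨ ⊠-cong (Π-+ f m n) ≈-refl ⟩
    Π f m ⊠ Π (λ z → f (m + z)) n ⊠ f (m + n)         ≈⟨ solve 3 (λ a b c → a :* b :* c := a :* (b :* c)) ≈-refl _ _ _ ⟩
    Π f m ⊠ (Π (λ z → f (m + z)) n ⊠ f (m + n))       ∎

  Π-⊠ : ∀ f g m → Π (λ z → f z ⊠ g z) m ≈ Π f m ⊠ Π g m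
  Π-⊠ f g zero    = ≈-sym (⊠-identityʳ 1#)
  Π-⊠ f g (suc m) = ≈-trans (⊠-cong (Π-⊠ f g m) ≈-refl)
    (solve 4 (λ a b c d → a :* b :* (c :* d) := a :* c :* (b :* d)) ≈-refl _ _ _ _)

  Π-head : ∀ f m → Π f (suc m) ≈ f 0 ⊠ Π (f ∘ suc) m
  Π-head f zero    = solve 1 (λ a → con 1 :* a := a :* con 1) ≈-refl (f 0)
  Π-head f (suc m) = ≈-trans (⊠-cong (Π-head f m) ≈-refl)
    (solve 3 (λ a b c → a :* b :* c := a :* (b :* c)) ≈-refl _ _ _)

  Π-reverse : ∀ f m → Π f m ≈ Π (λ z → f (m ∸ suc z)) m
  Π-reverse f zero    = ≈-refl
  Π-reverse f (suc m) = begin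
    Π f m ⊠ f m                          ≈⟨ ⊠-cong (Π-reverse f m) ≈-refl ⟩
    Π (λ z → f (m ∸ suc z)) m ⊠ f m      ≈⟨ solve 2 (λ a b → a :* b := b :* a) ≈-refl _ _ ⟩
    f m ⊠ Π (λ z → f (m ∸ suc z)) m      ≈⟨ Π-head (λ z → f (m ∸ z)) m ⟨
    Π (λ z → f (m ∸ z)) (suc m)          ∎

  -- The two nonzero residue classes modulo 3 are exchanged by i ↦ 3 m ∸ i.
  Π-thirds : ∀ f m → Π f (m * 3) ≈
    Π (λ z → f (z * 3)) m ⊠ Π (λ z → f (1 + z * 3) ⊠ f (2 + (m ∸ suc z) * 3)) m
  Π-thirds f m = begin
    Π f (m * 3)
      ≈⟨ residues m ⟩
    Π f₀ m ⊠ (Π f₁ m ⊠ Π f₂ m)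
      ≈⟨ ⊠-cong ≈-refl (⊠-cong ≈-refl (Π-reverse f₂ m)) ⟩
    Π f₀ m ⊠ (Π f₁ m ⊠ Π (λ z → f₂ (m ∸ suc z)) m)
      ≈⟨ ⊠-cong ≈-refl (Π-⊠ f₁ (λ z → f₂ (m ∸ suc z)) m) ⟨
    Π f₀ m ⊠ Π (λ z → f₁ z ⊠ f₂ (m ∸ suc z)) m
      ∎
    where
    f₀ f₁ f₂ : ℕ → Carrier
    f₀ z = f (z * 3)
    f₁ z = f (1 + z * 3)
    f₂ z = f (2 + z * 3)
    residues : ∀ m → Π f (m * 3) ≈ Π f₀ m ⊠ (Π f₁ m ⊠ Π f₂ m)
    residues zero    = solve 0 (con 1 := con 1 :* (con 1 :* con 1)) ≈-refl
    residues (suc m) = ≈-trans (⊠-cong (⊠-cong (⊠-cong (residues m) ≈-refl) ≈-refl) ≈-refl)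
      (solve 6 (λ a b c x y z → a :* (b :* c) :* x :* y :* z := a :* x :* (b :* y :* (c :* z)))
        ≈-refl _ _ _ _ _ _)

  -- A one-sided congruence modulo P, which avoids subtraction.
  infix 4 _≽_mod_
  _≽_mod_ : Carrier → Carrier → Carrier → Set _
  X ≽ Y mod P = ∃ λ A → X ≈ Y ⊞ P ⊠ A

  ≽-refl : ∀ {X P} → X ≽ X mod P
  ≽-refl {X} {P} = 0# , ≈-sym (≈-trans (⊞-cong ≈-refl (⊠-zeroʳ P)) (⊞-identityʳ X))

  ≽-trans : ∀ {X Y Z P} → X ≽ Y mod P → Y ≽ Z mod P → X ≽ Z mod P
  ≽-trans {X} {Y} {Z} {P} (A , X≈) (B , Y≈) = B ⊞ A , (begin
    X                     ≈⟨ X≈ ⟩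
    Y ⊞ P ⊠ A             ≈⟨ ⊞-cong Y≈ ≈-refl ⟩
    Z ⊞ P ⊠ B ⊞ P ⊠ A     ≈⟨ solve 4 (λ z p b a → z :+ p :* b :+ p :* a := z :+ p :* (b :+ a)) ≈-refl Z P B A ⟩
    Z ⊞ P ⊠ (B ⊞ A)       ∎)

  ≽-resp : ∀ {X X′ Y Y′ P P′} → X ≈ X′ → Y ≈ Y′ → P ≈ P′ → X ≽ Y mod P → X′ ≽ Y′ mod P′
  ≽-resp X≈ Y≈ P≈ (A , e) = A , ≈-trans (≈-sym X≈) (≈-trans e (⊞-cong Y≈ (⊠-cong P≈ ≈-refl)))

  ≽-⊠ : ∀ {X Y X′ Y′ P} → X ≽ Y mod P → X′ ≽ Y′ mod P → X ⊠ X′ ≽ Y ⊠ Y′ mod P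
  ≽-⊠ {X} {Y} {X′} {Y′} {P} (A , X≈) (B , X′≈) = A ⊠ Y′ ⊞ Y ⊠ B ⊞ P ⊠ A ⊠ B , ≈-trans (⊠-cong X≈ X′≈)
    (solve 5 (λ y y′ p a b → (y :+ p :* a) :* (y′ :+ p :* b) :=
        y :* y′ :+ p :* (a :* y′ :+ y :* b :+ p :* a :* b)) ≈-refl Y Y′ P A B)

  Π-≽ : ∀ {f g P} m → (∀ z → z < m → f z ≽ g z mod P) → Π f m ≽ Π g m mod P
  Π-≽ zero    f≽g = ≽-refl
  Π-≽ (suc m) f≽g = ≽-⊠ (Π-≽ m λ z z<m → f≽g z (m<n⇒m<1+n z<m)) (f≽g m ≤-refl)

  triple : Carrier → Carrier
  triple X = X ⊞ X ⊞ X

  -- With P = 3 Q, the mixed terms of the cube carry the binomial coefficient 3, and P³ contains P²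
  -- = 3 P Q. Cubing thus gains a factor 3 in the modulus.
  ≽-cube : ∀ {X Y} Q → X ≽ Y mod triple Q →
    X ⊠ (X ⊠ X) ≽ Y ⊠ (Y ⊠ Y) mod triple (triple Q)
  ≽-cube {X} {Y} Q (A , X≈) = _ , ≈-trans (⊠-cong X≈ (⊠-cong X≈ X≈))
    (solve 3 (λ y q a → let p = q :+ q :+ q ; x = y :+ p :* a in
       x :* (x :* x) := y :* (y :* y) :+ (p :+ p :+ p) :*
         (y :* y :* a :+ p :* a :* a :* y :+ p :* q :* a :* a :* a)) ≈-refl Y Q A)

  -- With P = 3 Q, the second order terms carry P² = 3 P Q; the first order ones
  -- do so too, because A + B is itself a multiple of P.
  ≽-triple : ∀ X Q A B C → A ⊞ B ≈ triple Q ⊠ C →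
    (X ⊞ triple Q ⊠ A) ⊠ ((X ⊞ triple Q ⊠ (A ⊞ B)) ⊠ (X ⊞ triple Q ⊠ B)) ≽
      X ⊠ (X ⊠ X) mod triple (triple Q)
  ≽-triple X Q A B C A+B≈ = _ , (begin
    (X ⊞ P ⊠ A) ⊠ ((X ⊞ P ⊠ (A ⊞ B)) ⊠ (X ⊞ P ⊠ B))
      ≈⟨ solve 4 (λ x q a b → let p = q :+ q :+ q in
           (x :+ p :* a) :* ((x :+ p :* (a :+ b)) :* (x :+ p :* b)) :=
           x :* (x :* x) :+ (x :* x :* (p :* ((a :+ b) :+ (a :+ b)))
             :+ (p :+ p :+ p) :* (q :* (x :* (a :* a :+ a :* b :+ a :* b :+ a :* b :+ b :* b) :+ p :* a :* b :* (a :+ b)))))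
           ≈-refl X Q A B ⟩
    X ⊠ (X ⊠ X) ⊞ (X ⊠ X ⊠ (P ⊠ ((A ⊞ B) ⊞ (A ⊞ B))) ⊞ triple P ⊠ (Q ⊠ E))
      ≈⟨ ⊞-cong ≈-refl (⊞-cong (⊠-cong ≈-refl (⊠-cong ≈-refl (⊞-cong A+B≈ A+B≈))) ≈-refl) ⟩
    X ⊠ (X ⊠ X) ⊞ (X ⊠ X ⊠ (P ⊠ (P ⊠ C ⊞ P ⊠ C)) ⊞ triple P ⊠ (Q ⊠ E))
      ≈⟨ solve 4 (λ x q c e → let p = q :+ q :+ q in
           x :* (x :* x) :+ (x :* x :* (p :* (p :* c :+ p :* c)) :+ (p :+ p :+ p) :* (q :* e)) :=
           x :* (x :* x) :+ (p :+ p :+ p) :* (q :* (x :* x :* (c :+ c) :+ e)))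
           ≈-refl X Q C E ⟩
    X ⊠ (X ⊠ X) ⊞ triple P ⊠ (Q ⊠ (X ⊠ X ⊠ (C ⊞ C) ⊞ E))
      ∎)
    where
    P E : Carrier
    P = triple Q
    E = X ⊠ (A ⊠ A ⊞ A ⊠ B ⊞ A ⊠ B ⊞ A ⊠ B ⊞ B ⊠ B) ⊞ P ⊠ A ⊠ B ⊠ (A ⊞ B)

  -- The inductive step of `homogenise-lin`: there `l` is 1 + N y, `q` is y², and `y` is the power
  -- y^(2 h + 2).
  homogenise-step : ∀ g l w q c c′ y →
    (g ⊠ (l ⊞ w ⊠ q) ⊞ c ⊠ y) ⊠ l ⊞ (c′ ⊞ w ⊠ c) ⊠ (y ⊠ q) ≈
    (g ⊠ l ⊞ c ⊠ y) ⊠ (l ⊞ w ⊠ q) ⊞ c′ ⊠ (y ⊠ q)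
  homogenise-step = solve 7 (λ g l w q c c′ y →
    (g :* (l :+ w :* q) :+ c :* y) :* l :+ (c′ :+ w :* c) :* (y :* q) :=
    (g :* l :+ c :* y) :* (l :+ w :* q) :+ c′ :* (y :* q)) ≈-refl

  homogenise-base : ∀ l w q c c′ →
    c ⊠ l ⊞ (c′ ⊞ w ⊠ c) ⊠ q ≈ c ⊠ (l ⊞ w ⊠ q) ⊞ c′ ⊠ q
  homogenise-base = solve 5 (λ l w q c c′ →
    c :* l :+ (c′ :+ w :* c) :* q := c :* (l :+ w :* q) :+ c′ :* q) ≈-refl

-- The congruence W ≡ (1 + 2 y)^m

open Products series

lin-⊛ : ∀ w f k → (f ⊛ lin w) (suc k) ≡ f (suc k) + w * f k
lin-⊛ w f k = trans (⊛-comm f (lin w) (suc k))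
  (cong₂ _+_ (*-identityˡ (f (suc k))) (scalar-⊛ w f k))

lin-⊛₀ : ∀ w f → (f ⊛ lin w) 0 ≡ f 0
lin-⊛₀ w f = *-identityʳ (f 0)

monomial : ℕ → Series
monomial c zero    = 0
monomial c (suc k) = scalar c k

lin-+ : ∀ w p c → lin (w + p * c) ≗ lin w ⊕ scalar p ⊛ monomial c
lin-+ w p c zero          = cong suc (sym (*-zeroʳ p))
lin-+ w p c (suc zero)    = cong (w +_) (sym (scalar-⊛ p (monomial c) 1))
lin-+ w p c (suc (suc k)) = sym (trans (scalar-⊛ p (monomial c) (suc (suc k))) (*-zeroʳ p))

monomial-+ : ∀ c d → monomial c ⊕ monomial d ≗ monomial (c + d)
monomial-+ c d zero          = refl
monomial-+ c d (suc zero)    = refl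
monomial-+ c d (suc (suc k)) = refl

monomial-* : ∀ p c → monomial (p * c) ≗ scalar p ⊛ monomial c
monomial-* p c zero          = sym (*-zeroʳ p)
monomial-* p c (suc zero)    = sym (scalar-⊛ p (monomial c) 1)
monomial-* p c (suc (suc k)) = sym (trans (scalar-⊛ p (monomial c) (suc (suc k))) (*-zeroʳ p))

triple-scalar : ∀ q → triple (scalar q) ≗ scalar (3 * q)
triple-scalar q zero    = lemma q
  where
  lemma : ∀ q → q + q + q ≡ 3 * q
  lemma = solve-∀
triple-scalar q (suc k) = refl

-- i (N - i) for N = 3 m and i = 3 z + 1; the truncated subtraction is exact for z < m.
weight : ℕ → ℕ → ℕ
weight m z = (1 + z * 3) * (2 + (m ∸ suc z) * 3)

W : ℕ → Series
W m = Π (λ z → lin (weight m z)) m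

L : ℕ → Series
L = Π (λ _ → lin 2)

L-+ : ∀ m n → L (m + n) ≗ L m ⊛ L n
L-+ m n = Π-+ (λ _ → lin 2) m n

-- Every weight is 1 · 2 modulo 3.
W-base : ∀ a → W a ≽ L a mod scalar 3
W-base a = Π-≽ a λ z _ → monomial (extra z (a ∸ suc z)) ,
  λ k → trans (cong (λ w → lin w k) (split z (a ∸ suc z))) (lin-+ 2 3 (extra z (a ∸ suc z)) k)
  where
  extra : ℕ → ℕ → ℕ
  extra z r = r + 2 * z + 3 * z * r
  split : ∀ z r → (1 + z * 3) * (2 + r * 3) ≡ 2 + 3 * (r + 2 * z + 3 * z * r)
  split = solve-∀

-- With i + j = 3 m, the points z, m + z and 2 m + z contribute the weights
-- i (j + 6 m), (i + 3 m) (j + 3 m) and (i + 6 m) j.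
W-step : ∀ a q → let m = a * q in
  W m ≽ L m mod scalar (3 * q) → W (m + (m + m)) ≽ L (m + (m + m)) mod scalar (3 * (3 * q))
W-step a q W≽L =
  ≽-trans (≽-resp (≗-sym expand) cubes modulus (Π-≽ m λ z z<m → factor z (m ∸ suc z) (sym (m+[n∸m]≡n z<m))))
    (≽-resp ≗-refl (≗-sym L-cube) modulus (≽-cube (scalar q) (≽-resp ≗-refl ≗-refl (≗-sym (triple-scalar q)) W≽L)))
  where
  open SetoidReasoning ≗-setoid
  m P : ℕ
  m = a * q
  P = 3 * q

  X : ℕ → Series
  X z = lin (weight m z)

  first second third : ℕ → Series
  first  z = lin ((1 + z * 3) * (2 + (m ∸ suc z + (m + m)) * 3))
  second z = lin ((1 + (m + z) * 3) * (2 + (m ∸ suc z + m) * 3))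
  third  z = lin ((1 + (m + (m + z)) * 3) * (2 + (m ∸ suc z) * 3))

  L-cube : L (m + (m + m)) ≗ L m ⊛ (L m ⊛ L m)
  L-cube = ≗-trans (L-+ m (m + m)) (⊛-cong ≗-refl (L-+ m m))

  modulus : triple (triple (scalar q)) ≗ scalar (3 * (3 * q))
  modulus = ≗-trans (⊕-cong (⊕-cong t t) t) (triple-scalar (3 * q))
    where
    t : triple (scalar q) ≗ scalar (3 * q)
    t = triple-scalar q

  cubes : Π (λ z → X z ⊛ (X z ⊛ X z)) m ≗ W m ⊛ (W m ⊛ W m)
  cubes = ≗-trans (Π-⊠ X (λ z → X z ⊛ X z) m) (⊛-cong ≗-refl (Π-⊠ X X m))

  expand : W (m + (m + m)) ≗ Π (λ z → first z ⊛ (second z ⊛ third z)) m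
  expand = begin
    W (m + (m + m))
      ≈⟨ Π-+ g m (m + m) ⟩
    Π g m ⊛ Π (λ z → g (m + z)) (m + m)
      ≈⟨ ⊛-cong ≗-refl (Π-+ (λ z → g (m + z)) m m) ⟩
    Π g m ⊛ (Π (λ z → g (m + z)) m ⊛ Π (λ z → g (m + (m + z))) m)
      ≈⟨ ⊛-cong (Π-cong m (λ z z<m → lin-≗ z (+-∸-comm (m + m) z<m)))
          (⊛-cong (Π-cong m λ z z<m → lin-≗ (m + z) (trans (shift z (m + m)) (+-∸-comm m z<m)))
                  (Π-cong m λ z _ → lin-≗ (m + (m + z)) (trans (shift (m + z) (m + m)) (shift z m)))) ⟩
    Π first m ⊛ (Π second m ⊛ Π third m)
      ≈⟨ ⊛-cong ≗-refl (Π-⊠ second third m) ⟨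
    Π first m ⊛ Π (λ z → second z ⊛ third z) m
      ≈⟨ Π-⊠ first (λ z → second z ⊛ third z) m ⟨
    Π (λ z → first z ⊛ (second z ⊛ third z)) m ∎
    where
    g : ℕ → Series
    g z = lin (weight (m + (m + m)) z)
    lin-≗ : ∀ z {r r′} → r ≡ r′ → lin ((1 + z * 3) * (2 + r * 3)) ≗ lin ((1 + z * 3) * (2 + r′ * 3))
    lin-≗ z refl = ≗-refl
    shift : ∀ z n → (m + n) ∸ suc (m + z) ≡ n ∸ suc z
    shift z n = trans (cong (m + n ∸_) (sym (+-suc m z))) ([m+n]∸[m+o]≡n∸o m n (suc z))

  factor : ∀ z r → m ≡ suc z + r → let Y = lin ((1 + z * 3) * (2 + r * 3)) in
    lin ((1 + z * 3) * (2 + (r + (m + m)) * 3)) ⊛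
      (lin ((1 + (m + z) * 3) * (2 + (r + m) * 3)) ⊛ lin ((1 + (m + (m + z)) * 3) * (2 + r * 3)))
    ≽ Y ⊛ (Y ⊛ Y) mod triple (triple (scalar q))
  factor z r m≡ = ≽-resp
    (⊛-cong (≗-sym (perturb e₁)) (⊛-cong
      (≗-sym (≗-trans (perturb e₂)
        (⊕-cong ≗-refl (⊛-cong {triple (scalar q)} ≗-refl (≗-sym (monomial-+ α β))))))
      (≗-sym (perturb e₃))))
    ≗-refl ≗-refl (≽-triple _ (scalar q) (monomial α) (monomial β) (monomial (2 * a * a)) α+β)
    where
    -- Write i = 1 + 3 z and j = 2 + 3 r. The outer weights exceed i j by 6 m i and 6 m j, and m = a
    -- q gives 6 m = 2 a P.
    α β : ℕ
    α = 2 * a * (1 + z * 3)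
    β = 2 * a * (2 + r * 3)
    A : ℕ
    A = (1 + z * 3) * (2 + r * 3)
    perturb : ∀ {w c} → w ≡ A + P * c → lin w ≗ lin A ⊕ triple (scalar q) ⊛ monomial c
    perturb {c = c} refl = ≗-trans (lin-+ A P c) (⊕-cong ≗-refl (⊛-cong (≗-sym (triple-scalar q)) ≗-refl))
    e₁ : (1 + z * 3) * (2 + (r + (m + m)) * 3) ≡ A + P * α
    e₁ = lemma a q z r
      where
      lemma : ∀ a q z r → (1 + z * 3) * (2 + (r + (a * q + a * q)) * 3) ≡
        (1 + z * 3) * (2 + r * 3) + 3 * q * (2 * a * (1 + z * 3))
      lemma = solve-∀
    -- The excess over i j is 3 m (i + j) + 9 m², which i + j = 3 m turns into 6 m (i + j).
    e₂ : (1 + (m + z) * 3) * (2 + (r + m) * 3) ≡ A + P * (α + β)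
    e₂ = trans (lemma m z r) (trans (cong (λ t → A + (3 * m * ((1 + z * 3) + (2 + r * 3)) + 3 * m * (3 * t))) m≡) (lemma′ a q z r))
      where
      lemma : ∀ m z r → (1 + (m + z) * 3) * (2 + (r + m) * 3) ≡
        (1 + z * 3) * (2 + r * 3) + (3 * m * ((1 + z * 3) + (2 + r * 3)) + 3 * m * (3 * m))
      lemma = solve-∀
      lemma′ : ∀ a q z r →
        (1 + z * 3) * (2 + r * 3) + (3 * (a * q) * ((1 + z * 3) + (2 + r * 3)) + 3 * (a * q) * (3 * (suc z + r))) ≡
        (1 + z * 3) * (2 + r * 3) + 3 * q * (2 * a * (1 + z * 3) + 2 * a * (2 + r * 3))
      lemma′ = solve-∀
    e₃ : (1 + (m + (m + z)) * 3) * (2 + r * 3) ≡ A + P * β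
    e₃ = lemma a q z r
      where
      lemma : ∀ a q z r → (1 + (a * q + (a * q + z)) * 3) * (2 + r * 3) ≡
        (1 + z * 3) * (2 + r * 3) + 3 * q * (2 * a * (2 + r * 3))
      lemma = solve-∀
    -- Since i + j = 3 a q, the sum 2 a (i + j) is itself a multiple of P = 3 q, as `≽-triple`
    -- requires.
    α+β : monomial α ⊕ monomial β ≗ triple (scalar q) ⊛ monomial (2 * a * a)
    α+β = begin
      monomial α ⊕ monomial β                      ≈⟨ monomial-+ α β ⟩
      monomial (α + β)                             ≡⟨ cong monomial (trans (lemma a z r) (trans (cong (2 * a * 3 *_) (sym m≡)) (lemma′ a q))) ⟩
      monomial (3 * q * (2 * a * a))               ≈⟨ monomial-* (3 * q) (2 * a * a) ⟩
      scalar (3 * q) ⊛ monomial (2 * a * a)        ≈⟨ ⊛-cong (triple-scalar q) ≗-refl ⟨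
      triple (scalar q) ⊛ monomial (2 * a * a)     ∎
      where
      lemma : ∀ a z r → 2 * a * (1 + z * 3) + 2 * a * (2 + r * 3) ≡ 2 * a * 3 * (suc z + r)
      lemma = solve-∀
      lemma′ : ∀ a q → 2 * a * 3 * (a * q) ≡ 3 * q * (2 * a * a)
      lemma′ = solve-∀

W-≽-L : ∀ a s → W (a * 3 ^ s) ≽ L (a * 3 ^ s) mod scalar (3 ^ suc s)
W-≽-L a zero    = subst (λ m → W m ≽ L m mod scalar 3) (sym (*-identityʳ a)) (W-base a)
W-≽-L a (suc s) = subst (λ m → W m ≽ L m mod scalar (3 ^ suc (suc s))) (lemma a (3 ^ s)) (W-step a (3 ^ s) (W-≽-L a s))
  where
  lemma : ∀ a q → a * q + (a * q + a * q) ≡ a * (3 * q)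
  lemma = solve-∀

-- Divisibility by powers of 3

*-swap : ∀ x y z → x * (y * z) ≡ y * (x * z)
*-swap = x∙yz≈y∙xz *-commutativeSemigroup

3∤1 : ¬ 3 ∣ℕ 1
3∤1 = >⇒∤ (s≤s (s≤s z≤n))

3∤2 : ¬ 3 ∣ℕ 2
3∤2 = >⇒∤ (s≤s (s≤s (s≤s z≤n)))

3∤* : ∀ {m n} → ¬ 3 ∣ℕ m → ¬ 3 ∣ℕ n → ¬ 3 ∣ℕ m * n
3∤* {m} {n} 3∤m 3∤n 3∣mn = [ 3∤m , 3∤n ]′ (euclidsLemma m n (from-yes (prime? 3)) 3∣mn)

3^-cancel : ∀ {u} → ¬ 3 ∣ℕ u → ∀ w {x} → 3 ^ w ∣ℕ u * x → 3 ^ w ∣ℕ x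
3^-cancel         3∤u zero    {x} _ = 1∣ x
3^-cancel {u} 3∤u (suc w) {x} d
  with euclidsLemma u x (from-yes (prime? 3)) (∣-trans (m∣m*n (3 ^ w)) d)
... | inj₁ 3∣u = contradiction 3∣u 3∤u
... | inj₂ (divides-refl q) = subst (3 ^ suc w ∣ℕ_) (*-comm 3 q)
  (*-monoʳ-∣ 3 (3^-cancel 3∤u w (*-cancelˡ-∣ 3 (subst (3 ^ suc w ∣ℕ_) (rotate u q) d))))
  where
  rotate : ∀ u q → u * (q * 3) ≡ 3 * (u * q)
  rotate = solve-∀

3^n≢0 : ∀ n → NonZero (3 ^ n)
3^n≢0 n = m^n≢0 3 n

3^-mono-∣ : ∀ {m n} → m ≤ n → 3 ^ m ∣ℕ 3 ^ n
3^-mono-∣ {m} {n} m≤n = subst (3 ^ m ∣ℕ_)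
  (trans (sym (^-distribˡ-+-* 3 m (n ∸ m))) (cong (3 ^_) (m+[n∸m]≡n m≤n))) (m∣m*n (3 ^ (n ∸ m)))

n<3^n : ∀ n → n < 3 ^ n
n<3^n zero    = s≤s z≤n
n<3^n (suc n) = ≤-trans (s≤s (n<3^n n)) (+-mono-≤ (m^n>0 3 n) (m≤m+n (3 ^ n) _))

-- Otherwise every power of 3 would divide q, among them 3^q, which exceeds q.
3^-unbounded : ∀ {q} → 0 < q → ¬ (∀ w → 3 ^ w ∣ℕ q → 3 ^ suc w ∣ℕ q)
3^-unbounded {q} 0<q step = <⇒≱ (n<3^n q) (∣⇒≤ {{>-nonZero 0<q}} (all q))
  where
  all : ∀ w → 3 ^ w ∣ℕ q
  all zero    = 1∣ q
  all (suc w) = step w (all w)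

-- The coefficients of (1 + 2 y)^m, and k W_k modulo powers of 3

L₀ : ∀ m → L m 0 ≡ 1
L₀ zero    = refl
L₀ (suc m) = trans (lin-⊛₀ 2 (L m)) (L₀ m)

-- The derivative of (1 + 2 y)^(m+1) is 2 (m + 1) (1 + 2 y)^m, compared coefficient by coefficient.
L-derivative : ∀ m k → suc k * L (suc m) (suc k) ≡ 2 * suc m * L m k
L-derivative zero    zero    = refl
L-derivative zero    (suc k) = trans (cong (suc (suc k) *_) (lin-⊛ 2 (L 0) (suc k))) (*-zeroʳ (suc (suc k)))
L-derivative (suc m) k = begin
  suc k * L (suc (suc m)) (suc k)                        ≡⟨ cong (suc k *_) (lin-⊛ 2 (L (suc m)) k) ⟩
  suc k * (L (suc m) (suc k) + 2 * L (suc m) k)          ≡⟨ *-distribˡ-+ (suc k) (L (suc m) (suc k)) _ ⟩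
  suc k * L (suc m) (suc k) + suc k * (2 * L (suc m) k)  ≡⟨ cong (_+ suc k * (2 * L (suc m) k)) (L-derivative m k) ⟩
  2 * suc m * L m k + suc k * (2 * L (suc m) k)          ≡⟨ rest k ⟩
  2 * suc (suc m) * L (suc m) k                          ∎
  where
  open ≡-Reasoning
  rest : ∀ k → 2 * suc m * L m k + suc k * (2 * L (suc m) k) ≡ 2 * suc (suc m) * L (suc m) k
  rest zero    rewrite L₀ (suc m) | L₀ m = lemma m
    where
    lemma : ∀ m → 2 * suc m * 1 + 1 * (2 * 1) ≡ 2 * suc (suc m) * 1
    lemma = solve-∀
  rest (suc k) = begin
    2 * suc m * L m (suc k) + suc (suc k) * (2 * x)            ≡⟨ l₁ m k (L m (suc k)) x ⟩
    2 * suc m * L m (suc k) + 2 * x + 2 * (suc k * x)          ≡⟨ cong (λ t → 2 * suc m * L m (suc k) + 2 * x + 2 * t) (L-derivative m k) ⟩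
    2 * suc m * L m (suc k) + 2 * x + 2 * (2 * suc m * L m k)  ≡⟨ l₂ m (L m (suc k)) x (L m k) ⟩
    2 * suc m * (L m (suc k) + 2 * L m k) + 2 * x              ≡⟨ cong (λ t → 2 * suc m * t + 2 * x) (lin-⊛ 2 (L m) k) ⟨
    2 * suc m * x + 2 * x                                      ≡⟨ l₃ m x ⟩
    2 * suc (suc m) * x                                        ∎
    where
    x : ℕ
    x = L (suc m) (suc k)
    l₁ : ∀ m k y x → 2 * suc m * y + suc (suc k) * (2 * x) ≡ 2 * suc m * y + 2 * x + 2 * (suc k * x)
    l₁ = solve-∀
    l₂ : ∀ m y x z → 2 * suc m * y + 2 * x + 2 * (2 * suc m * z) ≡ 2 * suc m * (y + 2 * z) + 2 * x
    l₂ = solve-∀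
    l₃ : ∀ m x → 2 * suc m * x + 2 * x ≡ 2 * suc (suc m) * x
    l₃ = solve-∀

-- The ratio of consecutive coefficients of (1 + 2 y)^m, with r = m - k; it comes from
-- `L-derivative` by Pascal's rule.
L-ratio : ∀ k r → suc k * L (k + r) (suc k) ≡ 2 * L (k + r) k * r
L-ratio k r = +-cancelʳ-≡ (suc k * (2 * L (k + r) k)) _ _ (begin
  suc k * L (k + r) (suc k) + suc k * (2 * L (k + r) k)  ≡⟨ *-distribˡ-+ (suc k) (L (k + r) (suc k)) _ ⟨
  suc k * (L (k + r) (suc k) + 2 * L (k + r) k)          ≡⟨ cong (suc k *_) (lin-⊛ 2 (L (k + r)) k) ⟨
  suc k * L (suc (k + r)) (suc k)                        ≡⟨ L-derivative (k + r) k ⟩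
  2 * suc (k + r) * L (k + r) k                          ≡⟨ split k r (L (k + r) k) ⟩
  2 * L (k + r) k * r + suc k * (2 * L (k + r) k)        ∎)
  where
  open ≡-Reasoning
  split : ∀ k r x → 2 * suc (k + r) * x ≡ 2 * x * r + suc k * (2 * x)
  split = solve-∀

-- For w ≤ s, 3^w divides the sum κ + ρ. For w > s, it cannot divide ρ, because 0 < ρ < a 3^s ≤
-- 3^(s+1).
complement-∣ : ∀ {a} s {κ ρ} → a < 3 → 0 < κ → 0 < ρ → κ + ρ ≡ a * 3 ^ s → ∀ w → 3 ^ w ∣ℕ ρ → 3 ^ w ∣ℕ κ
complement-∣ {a} s {κ} {ρ} a<3 0<κ 0<ρ κ+ρ≡ w d with w ≤? s
... | yes w≤s = ∣m+n∣m⇒∣n (subst (3 ^ w ∣ℕ_) (trans (sym κ+ρ≡) (+-comm κ ρ))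
                  (∣n⇒∣m*n a (3^-mono-∣ w≤s))) d
... | no  w≰s = contradiction (begin-strict
    ρ             <⟨ m<n+m ρ 0<κ ⟩
    κ + ρ         ≡⟨ κ+ρ≡ ⟩
    a * 3 ^ s     ≤⟨ *-monoˡ-≤ (3 ^ s) (<⇒≤ a<3) ⟩
    3 ^ suc s     ≤⟨ ^-monoʳ-≤ 3 (≰⇒> w≰s) ⟩
    3 ^ w         ≤⟨ ∣⇒≤ {{>-nonZero 0<ρ}} d ⟩
    ρ             ∎) (<-irrefl refl)
  where open ≤-Reasoning

-- Induction on k by `L-ratio`. The numbers k + 1 and r + 1 in the ratio add up to a 3^s, so a power
-- of 3 dividing r + 1 divides k + 1. A factor 3 in the new coefficient would then raise every power
-- of 3 in r + 1 by one.
L-unit : ∀ {a} s → a < 3 → ∀ k r → suc (k + r) ≡ a * 3 ^ s → ¬ 3 ∣ℕ L (k + r) k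
L-unit s a<3 zero    r _ 3∣L = 3∤1 (subst (3 ∣ℕ_) (L₀ r) 3∣L)
L-unit {a} s a<3 (suc k) r e 3∣L = 3^-unbounded {suc r} (s≤s z≤n) λ w d →
  3^-cancel (3∤* 3∤2 (L-unit s a<3 k (suc r) e′)) (suc w) (subst (3 ^ suc w ∣ℕ_)
    (trans (cong (λ m → suc k * L m (suc k)) (sym (+-suc k r))) (L-ratio k (suc r)))
    (subst (_∣ℕ suc k * L (suc k + r) (suc k)) (*-comm (3 ^ w) 3)
      (*-pres-∣ (complement-∣ s a<3 (s≤s z≤n) (s≤s z≤n) (trans (+-suc (suc k) r) e) w d) 3∣L)))
  where
  e′ : suc (k + suc r) ≡ a * 3 ^ s
  e′ = trans (cong suc (+-suc k r)) e

W-coefficient : ∀ a s → ∃ λ A → ∀ k → W (a * 3 ^ s) k ≡ L (a * 3 ^ s) k + 3 ^ suc s * A k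
W-coefficient a s with W-≽-L a s
... | A , W≈ = A , λ k → trans (W≈ k) (cong (L (a * 3 ^ s) k +_) (scalar-⊛ (3 ^ suc s) A k))

-- Modulo 3^(s+1) the series W may be replaced by (1 + 2 y)^(a 3^s), whose derivative brings down
-- the exponent a 3^s.
*-W : ∀ a s m k → suc m ≡ a * 3 ^ s → ∃ λ x →
  suc k * W (suc m) (suc k) ≡ 3 ^ s * (2 * a * L m k) + 3 ^ suc s * x
*-W a s m k e with W-coefficient a s
... | A , W≡ = suc k * A (suc k) , (begin
  suc k * W (suc m) (suc k)
    ≡⟨ cong (suc k *_) (trans (cong (λ t → W t (suc k)) e) (W≡ (suc k))) ⟩
  suc k * (L (a * 3 ^ s) (suc k) + 3 ^ suc s * A (suc k))
    ≡⟨ cong (λ t → suc k * (L t (suc k) + 3 ^ suc s * A (suc k))) e ⟨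
  suc k * (L (suc m) (suc k) + 3 ^ suc s * A (suc k))
    ≡⟨ l₁ (suc k) (L (suc m) (suc k)) (3 ^ suc s) (A (suc k)) ⟩
  suc k * L (suc m) (suc k) + 3 ^ suc s * (suc k * A (suc k))
    ≡⟨ cong (_+ 3 ^ suc s * (suc k * A (suc k))) (trans (L-derivative m k) (trans (cong (λ t → 2 * t * L m k) e) (l₂ a (3 ^ s) (L m k)))) ⟩
  3 ^ s * (2 * a * L m k) + 3 ^ suc s * (suc k * A (suc k)) ∎)
  where
  open ≡-Reasoning
  l₁ : ∀ k l p x → k * (l + p * x) ≡ k * l + p * (k * x)
  l₁ = solve-∀
  l₂ : ∀ a p x → 2 * (a * p) * x ≡ p * (2 * a * x)
  l₂ = solve-∀


-- Comparison of 3-adic valuations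

-- v₃(x) ≤ v₃(y), with v₃(0) = ∞.
infix 4 _⊑_
_⊑_ : ℕ → ℕ → Set
x ⊑ y = ∀ w → 3 ^ w ∣ℕ x → 3 ^ w ∣ℕ y

⊑-reflexive : ∀ {x y} → x ≡ y → x ⊑ y
⊑-reflexive refl w d = d

⊑-trans : ∀ {x y z} → x ⊑ y → y ⊑ z → x ⊑ z
⊑-trans x⊑y y⊑z w d = y⊑z w (x⊑y w d)

∣⇒⊑ : ∀ {x y} → x ∣ℕ y → x ⊑ y
∣⇒⊑ x∣y w d = ∣-trans d x∣y

3*-mono-⊑ : ∀ {x y} → x ⊑ y → 3 * x ⊑ 3 * y
3*-mono-⊑ x⊑y zero    d = 1∣ _
3*-mono-⊑ x⊑y (suc w) d = *-monoʳ-∣ 3 (x⊑y w (*-cancelˡ-∣ 3 d))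

3^-mono-⊑ : ∀ c {x y} → x ⊑ y → 3 ^ c * x ⊑ 3 ^ c * y
3^-mono-⊑ zero    {x} {y} x⊑y = ⊑-trans (⊑-reflexive (+-identityʳ x)) (⊑-trans x⊑y (⊑-reflexive (sym (+-identityʳ y))))
3^-mono-⊑ (suc c) {x} {y} x⊑y = ⊑-trans (⊑-reflexive (*-assoc 3 (3 ^ c) x))
  (⊑-trans (3*-mono-⊑ (3^-mono-⊑ c x⊑y)) (⊑-reflexive (sym (*-assoc 3 (3 ^ c) y))))

9^-mono-⊑ : ∀ c {x y} → x ⊑ y → 9 ^ c * x ⊑ 9 ^ c * y
9^-mono-⊑ c {x} {y} x⊑y = subst (λ p → p * x ⊑ p * y) (sym (^-*-assoc 3 2 c)) (3^-mono-⊑ (2 * c) x⊑y)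

∤⇒⊑ : ∀ {n x} y → ¬ 3 ^ n ∣ℕ x → 3 * x ⊑ 3 ^ n * y
∤⇒⊑     y ∤x zero    d = 1∣ _
∤⇒⊑ {n} y ∤x (suc w) d with suc w ≤? n
... | yes w<n = ∣m⇒∣m*n y (3^-mono-∣ w<n)
... | no  w≮n = contradiction (∣-trans (3^-mono-∣ (≤-pred (≰⇒> w≮n))) (*-cancelˡ-∣ 3 d)) ∤x

-- For x ≠ 0, `3 * x ⊑ y` encodes the strict inequality v₃(x) < v₃(y); for x = 0 it forces y = 0. A
-- sum then has the valuation of the dominant term x.
⊑-dominant : ∀ {x y} → 3 * x ⊑ y → x ⊑ x + y
⊑-dominant 3x⊑y w d = ∣m∣n⇒∣m+n d (3x⊑y w (∣n⇒∣m*n 3 d))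

-- Induction on the exponent: once 3^w divides x, 3^(w+1) divides 3 x, hence y, hence the difference
-- x.
dominant-⊑ : ∀ {x y} → 3 * x ⊑ y → x + y ⊑ x
dominant-⊑         3x⊑y zero    d = 1∣ _
dominant-⊑ {x} {y} 3x⊑y (suc w) d = ∣m+n∣m⇒∣n (subst (3 ^ suc w ∣ℕ_) (+-comm x y) d)
  (3x⊑y (suc w) (*-monoʳ-∣ 3 (dominant-⊑ 3x⊑y w (∣-trans (n∣m*n 3) d))))

-- Fewer than e factors 3 come from q, so 3^e can replace it.
3^-∣-factor : ∀ e {s q x} → ¬ 3 ^ e ∣ℕ q → 3 ^ s ∣ℕ q * x → 3 ^ s ∣ℕ 3 ^ e * x
3^-∣-factor zero    {q = q} ∤q d = contradiction (1∣ q) ∤q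
3^-∣-factor (suc e) {s} {q} {x} ∤q d with 3 ∣? q
... | no 3∤q = ∣n⇒∣m*n (3 ^ suc e) (3^-cancel 3∤q s d)
3^-∣-factor (suc e) {zero}  {q} {x} ∤q d | yes _ = 1∣ _
3^-∣-factor (suc e) {suc s} {q} {x} ∤q d | yes (divides-refl q′) =
  subst (3 ^ suc s ∣ℕ_) (sym (*-assoc 3 (3 ^ e) x)) (*-monoʳ-∣ 3 (3^-∣-factor e {s}
    (λ d′ → ∤q (subst (_∣ℕ q′ * 3) (*-comm (3 ^ e) 3) (*-monoˡ-∣ {3 ^ e} {q′} 3 d′)))
    (*-cancelˡ-∣ 3 (subst (3 ^ suc s ∣ℕ_) (trans (cong (_* x) (*-comm q′ 3)) (*-assoc 3 q′ x)) d))))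

9^≡3^*3^ : ∀ n → 9 ^ n ≡ 3 ^ n * 3 ^ n
9^≡3^*3^ n = trans (^-*-assoc 3 2 n)
  (trans (cong (λ t → 3 ^ (n + t)) (+-identityʳ n)) (^-distribˡ-+-* 3 n n))

-- From q < 3^q, fewer than q factors 3 lie in q, so 3^q and a fortiori 9^q can replace it.
3^-∣-9^ : ∀ {s q x} → 0 < q → 3 ^ s ∣ℕ q * x → 3 ^ s ∣ℕ 9 ^ q * x
3^-∣-9^ {s} {q} {x} 0<q d = ∣-trans (3^-∣-factor q {s} (>⇒∤ {{>-nonZero 0<q}} (n<3^n q)) d)
  (*-monoˡ-∣ x (subst (3 ^ q ∣ℕ_) (sym (9^≡3^*3^ q)) (m∣m*n (3 ^ q))))

-- Single terms of a convolution, and degrees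

⊛-∣ : ∀ c {d} f g k → (∀ i j → i + j ≡ k → d ∣ℕ c * (f i * g j)) → d ∣ℕ c * (f ⊛ g) k
⊛-∣ c {d} f g zero    t = t 0 0 refl
⊛-∣ c {d} f g (suc k) t = subst (d ∣ℕ_) (sym (*-distribˡ-+ c (f 0 * g (suc k)) _))
  (∣m∣n⇒∣m+n (t 0 (suc k) refl) (⊛-∣ c (f ∘ suc) g k λ i j e → t (suc i) j (cong suc e)))

-- Isolates the term that is to dominate. The remainder is known only through divisors common to its
-- terms; the multiplier c allows for a prior multiplication by the index.
⊛-split : ∀ f g k i₀ j₀ → i₀ + j₀ ≡ k → ∃ λ rest → (f ⊛ g) k ≡ f i₀ * g j₀ + rest ×
  (∀ c {d} → (∀ i j → i + j ≡ k → i ≢ i₀ → d ∣ℕ c * (f i * g j)) → d ∣ℕ c * rest)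
⊛-split f g zero    zero     zero     refl = 0 , sym (+-identityʳ _) , λ c {d} _ → subst (d ∣ℕ_) (sym (*-zeroʳ c)) (d ∣0)
⊛-split f g (suc k) zero     .(suc k) refl = ((f ∘ suc) ⊛ g) k , refl ,
  λ c t → ⊛-∣ c (f ∘ suc) g k λ i j e → t (suc i) j (cong suc e) λ ()
⊛-split f g (suc k) (suc i₀) j₀       e    with ⊛-split (f ∘ suc) g k i₀ j₀ (suc-injective e)
... | rest , e′ , t′ = f 0 * g (suc k) + rest ,
  trans (cong (f 0 * g (suc k) +_) e′) (x∙yz≈y∙xz +-commutativeSemigroup (f 0 * g (suc k)) (f (suc i₀) * g j₀) rest) ,
  λ c {d} t → subst (d ∣ℕ_) (sym (*-distribˡ-+ c (f 0 * g (suc k)) rest))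
    (∣m∣n⇒∣m+n (t 0 (suc k) refl λ ()) (t′ c λ i j e″ i≢ → t (suc i) j (cong suc e″) (i≢ ∘ suc-injective)))

Degree≤ : Series → ℕ → Set
Degree≤ f d = ∀ k → d < k → f k ≡ 0

degree-⊛ : ∀ {f g d e} → Degree≤ f d → Degree≤ g e → Degree≤ (f ⊛ g) (d + e)
degree-⊛ {f} {g} {d} {e} f≤d g≤e k d+e<k =
  -- Divisibility by 0 means vanishing, so `⊛-∣` applies with d = 0.
  trans (sym (+-identityʳ _)) (0∣⇒≡0 (⊛-∣ 1 f g k vanish))
  where
  vanish : ∀ i j → i + j ≡ k → 0 ∣ℕ 1 * (f i * g j)
  vanish i j refl with d <? i
  ... | yes d<i = ∣n⇒∣m*n 1 (∣m⇒∣m*n (g j) (∣-reflexive (sym (f≤d i d<i))))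
  ... | no  d≮i = ∣n⇒∣m*n 1 (∣n⇒∣m*n (f i) (∣-reflexive (sym (g≤e j
    (+-cancelˡ-< d e j (<-≤-trans d+e<k (+-monoˡ-≤ j (≮⇒≥ d≮i))))))))

degree-lin : ∀ w → Degree≤ (lin w) 1
degree-lin w (suc zero)    (s≤s ())
degree-lin w (suc (suc k)) _ = refl

degree-Π : ∀ (w : ℕ → ℕ) m → Degree≤ (Π (λ z → lin (w z)) m) m
degree-Π w zero    (suc k) _ = refl
degree-Π w (suc m) = subst (Degree≤ _) (+-comm m 1) (degree-⊛ {Π (λ z → lin (w z)) m} (degree-Π w m) (degree-lin (w m)))

Π-lin₀ : ∀ (w : ℕ → ℕ) m → Π (λ z → lin (w z)) m 0 ≡ 1
Π-lin₀ w zero    = refl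
Π-lin₀ w (suc m) = trans (lin-⊛₀ (w m) (Π (λ z → lin (w z)) m)) (Π-lin₀ w m)

scale : ℕ → Series → Series
scale c f k = c ^ k * f k


-- The induction on n

module Roots (a : ℕ) (0<a : 0 < a) (a<3 : a < 3) where

  3∤a : ¬ 3 ∣ℕ a
  3∤a = >⇒∤ {{>-nonZero 0<a}} a<3

  M : ℕ → ℕ
  M s = a * 3 ^ s

  M>0 : ∀ s → 0 < M s
  M>0 s = *-mono-≤ 0<a (m^n>0 3 s)

  pred-M : ∀ s → ∃ λ m → suc m ≡ M s
  pred-M s with M s | M>0 s
  ... | suc m | _ = m , refl

  3^s∣k*W : ∀ s k → 3 ^ s ∣ℕ k * W (M s) k
  3^s∣k*W s zero    = _ ∣0
  3^s∣k*W s (suc k) with pred-M s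
  ... | m , e with *-W a s m k e
  ...   | x , kW≡ = subst (λ t → 3 ^ s ∣ℕ suc k * W t (suc k)) e (subst (3 ^ s ∣ℕ_) (sym kW≡)
    (∣m∣n⇒∣m+n (m∣m*n (2 * a * L m k)) (∣m⇒∣m*n x (n∣m*n 3))))

  -- In `*-W` the cofactor of 3^s is a product of 2, a and a coefficient covered by `L-unit`, all
  -- prime to 3.
  3^1+s∤k*W : ∀ s k → 0 < k → k ≤ M s → ¬ 3 ^ suc s ∣ℕ k * W (M s) k
  3^1+s∤k*W s (suc k) _ k<M d with pred-M s
  ... | m , e with *-W a s m k e
  ...   | x , kW≡ = 3∤* (3∤* 3∤2 3∤a) 3∤L
    (*-cancelˡ-∣ (3 ^ s) {{3^n≢0 s}} (subst (_∣ℕ 3 ^ s * (2 * a * L m k)) (*-comm 3 (3 ^ s))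
      (∣m+n∣m⇒∣n (subst (3 ^ suc s ∣ℕ_) (trans kW≡ (+-comm (3 ^ s * (2 * a * L m k)) _)) d′) (m∣m*n x))))
    where
    d′ : 3 ^ suc s ∣ℕ suc k * W (suc m) (suc k)
    d′ = subst (λ t → 3 ^ suc s ∣ℕ suc k * W t (suc k)) (sym e) d
    k+r≡m : k + (m ∸ k) ≡ m
    k+r≡m = m+[n∸m]≡n (≤-pred (subst (suc k ≤_) (sym e) k<M))
    3∤L : ¬ 3 ∣ℕ L m k
    3∤L = subst (λ t → ¬ 3 ∣ℕ L t k) k+r≡m (L-unit s a<3 k (m ∸ k) (trans (cong suc k+r≡m) e))

  -- D s k is the symmetric function e_k for n = s, and deg s is the number h of factors.
  D : ℕ → Series
  D zero    = scalar 1
  D (suc s) = scale 9 (D s) ⊛ W (M s)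

  deg : ℕ → ℕ
  deg zero    = 0
  deg (suc s) = M s + deg s

  degree-scale : ∀ c {f d} → Degree≤ f d → Degree≤ (scale c f) d
  degree-scale c f≤d k d<k = trans (cong (c ^ k *_) (f≤d k d<k)) (*-zeroʳ (c ^ k))

  degree-D : ∀ s → Degree≤ (D s) (deg s)
  degree-D zero    (suc k) _ = refl
  degree-D (suc s) = subst (Degree≤ (D (suc s))) (+-comm (deg s) (M s))
    (degree-⊛ {scale 9 (D s)} (degree-scale 9 {D s} (degree-D s)) (degree-Π (weight (M s)) (M s)))

  D₀ : ∀ s → D s 0 ≡ 1
  D₀ zero    = refl
  D₀ (suc s) = trans (cong₂ (λ x y → 1 * x * y) (D₀ s) (Π-lin₀ (weight (M s)) (M s))) refl

  -- The final argument uses `downward`; the other fields carry the induction. The factor 3 in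
  -- `derivative` avoids the exponent s - 1; in the other two it expresses strictness.
  record Valuations (s : ℕ) : Set where
    field
      derivative : ∀ k → 3 ^ s ∣ℕ 3 * (k * D s k)
      upward     : ∀ k l → k < l → 3 * D s k ⊑ 3 ^ s * D s l
      downward   : ∀ k → k < deg s → 3 * D s (suc k) ⊑ 9 ^ s * D s k

  module Step (s : ℕ) (V : Valuations s) where
    open Valuations V

    m : ℕ
    m = M s

    E f F : Series
    E = W m
    f = scale 9 (D s)
    F = D (suc s)

    3^s∣m : 3 ^ s ∣ℕ m
    3^s∣m = n∣m*n a

    -- For i > 0, one 3 of the factor 9 in 9^i completes `derivative`, and the other raises the
    -- exponent to s + 1.
    derivative-f : ∀ i → 3 ^ suc s ∣ℕ i * f i
    derivative-f zero    = _ ∣0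
    derivative-f (suc i) = subst (3 ^ suc s ∣ℕ_) (lemma (suc i) (9 ^ i) (D s (suc i)))
      (∣n⇒∣m*n (9 ^ i) (*-monoʳ-∣ 3 (derivative (suc i))))
      where
      lemma : ∀ i p x → p * (3 * (3 * (i * x))) ≡ i * (9 * p * x)
      lemma = solve-∀

    -- The product rule for y d/dy on a single term of the convolution, with a multiplier c.
    leibniz : ∀ i j c → c * (i + j) * (f i * E j) ≡ c * (i * f i) * E j + f i * (c * (j * E j))
    leibniz i j c = lemma i j c (f i) (E j)
      where
      lemma : ∀ i j c x y → c * (i + j) * (x * y) ≡ c * (i * x) * y + x * (c * (j * y))
      lemma = solve-∀

    derivative′ : ∀ k → 3 ^ suc s ∣ℕ 3 * (k * F k)
    derivative′ k = subst (3 ^ suc s ∣ℕ_) (*-assoc 3 k (F k)) (⊛-∣ (3 * k) f E k λ { i j refl →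
      subst (3 ^ suc s ∣ℕ_) (sym (leibniz i j 3)) (∣m∣n⇒∣m+n
        (∣m⇒∣m*n (E j) (∣n⇒∣m*n 3 (derivative-f i)))
        (∣n⇒∣m*n (f i) (*-monoʳ-∣ 3 (3^s∣k*W s j)))) })

    -- After multiplication by k > 0, the term with i = 0 is k E_k, of valuation exactly s. By
    -- `leibniz` the others are divisible by 3^(s+1), since 3 divides f_i for i > 0.
    F-small : ∀ k → k ≤ m → ¬ 3 ^ suc s ∣ℕ F k
    F-small zero    _   d = 3∤1 (subst (3 ∣ℕ_) (D₀ (suc s)) (∣-trans (m∣m*n (3 ^ s)) d))
    F-small (suc k) k<m d with ⊛-split f E (suc k) 0 (suc k) refl
    ... | rest , F≡ , ∣rest = 3^1+s∤k*W s (suc k) (s≤s z≤n) k<m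
      (∣m+n∣m⇒∣n (subst (3 ^ suc s ∣ℕ_) e (∣n⇒∣m*n (suc k) d)) (∣rest (suc k) λ
        { zero    j _ 0≢0 → contradiction refl 0≢0
        ; (suc i) j i+j≡ _ → subst (3 ^ suc s ∣ℕ_) (trans (sym (leibniz (suc i) j 1)) (cong (_* (f (suc i) * E j)) (trans (+-identityʳ _) i+j≡)))
            (∣m∣n⇒∣m+n (∣m⇒∣m*n (E j) (∣n⇒∣m*n 1 (derivative-f (suc i))))
              (*-pres-∣ (∣m⇒∣m*n (D s (suc i)) (∣m⇒∣m*n (9 ^ i) (m∣m*n {3} 3))) (∣n⇒∣m*n 1 (3^s∣k*W s j)))) }))
      where
      e : suc k * F (suc k) ≡ suc k * rest + suc k * E (suc k)
      e = begin
        suc k * F (suc k)                       ≡⟨ cong (suc k *_) F≡ ⟩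
        suc k * (1 * D s 0 * E (suc k) + rest)  ≡⟨ cong (λ t → suc k * (1 * t * E (suc k) + rest)) (D₀ s) ⟩
        suc k * (1 * 1 * E (suc k) + rest)      ≡⟨ lemma (suc k) (E (suc k)) rest ⟩
        suc k * rest + suc k * E (suc k)        ∎
        where
        open ≡-Reasoning
        lemma : ∀ k x y → k * (1 * 1 * x + y) ≡ k * y + k * x
        lemma = solve-∀

    3∤E : ¬ 3 ∣ℕ E m
    3∤E d = 3^1+s∤k*W s m (M>0 s) ≤-refl (subst (_∣ℕ m * E m) (*-comm (3 ^ s) 3) (*-pres-∣ 3^s∣m d))

    -- As q = m - j, 3^s divides q E_j = m E_j - j E_j; then 9^q replaces q.
    E-complement : ∀ q j → 0 < q → q + j ≡ m → 3 ^ s ∣ℕ 9 ^ q * E j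
    E-complement q j 0<q q+j≡m = 3^-∣-9^ {s} 0<q (∣m+n∣m⇒∣n
      (subst (3 ^ s ∣ℕ_) (trans (cong (_* E j) (trans (sym q+j≡m) (+-comm q j))) (*-distribʳ-+ (E j) j q)) (∣m⇒∣m*n (E j) 3^s∣m))
      (3^s∣k*W s j))

    -- For i < l, the index j exceeds the degree m of E. For i = l + q with q > 0, `upward` loses at
    -- most s factors 3, and 9^q E_j makes up for them by `E-complement`.
    rest-⊒ : ∀ l w → 3 ^ w ∣ℕ 3 * f l → ∀ i j → i + j ≡ l + m → i ≢ l → 3 ^ w ∣ℕ 1 * (f i * E j)
    rest-⊒ l w d i j i+j≡ i≢l with <-cmp i l
    ... | tri≈ _ i≡l _ = contradiction i≡l i≢l
    ... | tri< i<l _ _ = ∣n⇒∣m*n 1 (∣n⇒∣m*n (f i) (subst (3 ^ w ∣ℕ_) (sym (degree-Π (weight m) m j m<j)) (_ ∣0)))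
      where
      m<j : m < j
      m<j = +-cancelˡ-< i m j (<-≤-trans (+-monoˡ-< m i<l) (≤-reflexive (sym i+j≡)))
    ... | tri> _ _ l<i = *-cancelˡ-∣ (3 ^ s) {{3^n≢0 s}} (subst (_∣ℕ 3 ^ s * (1 * (f i * E j))) (*-comm (3 ^ w) (3 ^ s))
            (subst (3 ^ w * 3 ^ s ∣ℕ_) e (*-pres-∣ d′ (E-complement q j (m<n⇒0<n∸m l<i) q+j≡m))))
      where
      q : ℕ
      q = i ∸ l
      l+q≡i : l + q ≡ i
      l+q≡i = m+[n∸m]≡n (<⇒≤ l<i)
      q+j≡m : q + j ≡ m
      q+j≡m = +-cancelˡ-≡ l _ _ (trans (sym (+-assoc l q j)) (trans (cong (_+ j) l+q≡i) i+j≡))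
      d′ : 3 ^ w ∣ℕ 9 ^ l * (3 ^ s * D s i)
      d′ = 9^-mono-⊑ l (upward l i l<i) w (subst (3 ^ w ∣ℕ_) (*-swap 3 (9 ^ l) (D s l)) d)
      e : 9 ^ l * (3 ^ s * D s i) * (9 ^ q * E j) ≡ 3 ^ s * (1 * (9 ^ i * D s i * E j))
      e = trans (lemma (9 ^ l) (3 ^ s) (D s i) (9 ^ q) (E j))
        (cong (λ t → 3 ^ s * (1 * (t * D s i * E j))) (trans (sym (^-distribˡ-+-* 9 l q)) (cong (9 ^_) l+q≡i)))
        where
        lemma : ∀ p t x r y → p * (t * x) * (r * y) ≡ t * (1 * (p * r * x * y))
        lemma = solve-∀

    -- The term f_l E_m dominates its coefficient, and E_m is prime to 3.
    F-large : ∀ l → F (m + l) ⊑ f l × f l ⊑ F (m + l)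
    F-large l with ⊛-split f E (m + l) l m (+-comm l m)
    ... | rest , F≡ , ∣rest =
      ⊑-trans (⊑-reflexive F≡) (⊑-trans (dominant-⊑ small) unit) ,
      ⊑-trans (∣⇒⊑ (m∣m*n (E m))) (⊑-trans (⊑-dominant small) (⊑-reflexive (sym F≡)))
      where
      unit : f l * E m ⊑ f l
      unit w d = 3^-cancel 3∤E w (subst (3 ^ w ∣ℕ_) (*-comm (f l) (E m)) d)
      small : 3 * (f l * E m) ⊑ rest
      small w d = subst (3 ^ w ∣ℕ_) (+-identityʳ rest) (∣rest 1 λ i j i+j≡ →
        rest-⊒ l w (3^-cancel 3∤E w (subst (3 ^ w ∣ℕ_) (lemma (f l) (E m)) d)) i j (trans i+j≡ (+-comm m l)))
        where
        lemma : ∀ x u → 3 * (x * u) ≡ u * (3 * x)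
        lemma = solve-∀

    -- Up to m, `F-small` suffices. Beyond m, `F-large` carries over the inequality for s, and 9^k′
    -- divides 9^l′.
    upward′ : ∀ k l → k < l → 3 * F k ⊑ 3 ^ suc s * F l
    upward′ k l k<l with k ≤? m
    ... | yes k≤m = ∤⇒⊑ {suc s} (F l) (F-small k k≤m)
    ... | no  k≰m = subst (λ t → 3 * F t ⊑ 3 ^ suc s * F l) (m+[n∸m]≡n m≤k)
                      (subst (λ t → 3 * F (m + k′) ⊑ 3 ^ suc s * F t) (m+[n∸m]≡n (≤-trans m≤k (<⇒≤ k<l))) shifted)
      where
      m≤k : m ≤ k
      m≤k = <⇒≤ (≰⇒> k≰m)
      k′ l′ : ℕ
      k′ = k ∸ m
      l′ = l ∸ m
      k′<l′ : k′ < l′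
      k′<l′ = ∸-monoˡ-< k<l m≤k
      9^-∣ : 9 ^ k′ ∣ℕ 9 ^ l′
      9^-∣ = subst (9 ^ k′ ∣ℕ_) (trans (sym (^-distribˡ-+-* 9 k′ (l′ ∸ k′))) (cong (9 ^_) (m+[n∸m]≡n (<⇒≤ k′<l′))))
        (m∣m*n (9 ^ (l′ ∸ k′)))
      shifted : 3 * F (m + k′) ⊑ 3 ^ suc s * F (m + l′)
      shifted =
        ⊑-trans (3*-mono-⊑ (proj₁ (F-large k′)))
        (⊑-trans (⊑-reflexive (*-swap 3 (9 ^ k′) (D s k′)))
        (⊑-trans (9^-mono-⊑ k′ (upward k′ l′ k′<l′))
        (⊑-trans (⊑-reflexive (*-swap (9 ^ k′) (3 ^ s) (D s l′)))
        (⊑-trans (∣⇒⊑ (*-monoʳ-∣ (3 ^ s) (*-monoˡ-∣ (D s l′) 9^-∣)))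
        (⊑-trans (3^-mono-⊑ s (proj₂ (F-large l′)))
        (∣⇒⊑ (*-monoˡ-∣ (F (m + l′)) (n∣m*n 3 {3 ^ s}))))))))

    -- For k < m, `F-small` at k + 1 suffices. From m on, `F-large` carries over the inequality for
    -- s, and the additional 9 in 9^(l+1) turns 9^s into 9^(s+1).
    downward′ : ∀ k → k < deg (suc s) → 3 * F (suc k) ⊑ 9 ^ suc s * F k
    downward′ k k<deg with suc k ≤? m
    ... | yes k<m = ⊑-trans (∤⇒⊑ {suc s} (3 ^ suc s * F k) (F-small (suc k) k<m))
            (⊑-reflexive (trans (sym (*-assoc (3 ^ suc s) (3 ^ suc s) (F k))) (cong (_* F k) (sym (9^≡3^*3^ (suc s))))))
    ... | no k≮m = subst (λ t → 3 * F (suc t) ⊑ 9 ^ suc s * F t) m+l≡k shifted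
      where
      l : ℕ
      l = k ∸ m
      m+l≡k : m + l ≡ k
      m+l≡k = m+[n∸m]≡n (≤-pred (≰⇒> k≮m))
      l<deg : l < deg s
      l<deg = +-cancelˡ-< m l (deg s) (subst (_< m + deg s) (sym m+l≡k) k<deg)
      lemma : ∀ p t x → 9 * p * (t * x) ≡ 9 * t * (p * x)
      lemma = solve-∀
      shifted : 3 * F (suc (m + l)) ⊑ 9 ^ suc s * F (m + l)
      shifted =
        ⊑-trans (⊑-reflexive (cong (λ t → 3 * F t) (sym (+-suc m l))))
        (⊑-trans (3*-mono-⊑ (proj₁ (F-large (suc l))))
        (⊑-trans (⊑-reflexive (*-swap 3 (9 ^ suc l) (D s (suc l))))
        (⊑-trans (9^-mono-⊑ (suc l) (downward l l<deg))
        (⊑-trans (⊑-reflexive (lemma (9 ^ l) (9 ^ s) (D s l)))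
        (9^-mono-⊑ (suc s) (proj₂ (F-large l)))))))

  valuations : ∀ s → Valuations s
  valuations zero    = record
    { derivative = λ k → 1∣ _
    ; upward     = λ { k (suc l) _ w d → _ ∣0 }
    ; downward   = λ k () }
  valuations (suc s) = record { derivative = derivative′ ; upward = upward′ ; downward = downward′ }
    where open Step s (valuations s)

-- From symmetric functions to Stirling numbers

y² : Series
y² zero          = 0
y² (suc zero)    = 0
y² (suc (suc k)) = scalar 1 k

⊛-y² : ∀ f k → (f ⊛ y²) (suc (suc k)) ≡ f k
⊛-y² f k = trans (⊛-comm f y² (suc (suc k))) (⊛-identityˡ f k)

⊛-y²₁ : ∀ f → (f ⊛ y²) 1 ≡ 0
⊛-y²₁ f = ⊛-comm f y² 1

y^2* : ℕ → Series
y^2* = Π (λ _ → y²)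

y^2*-diagonal : ∀ h → y^2* h (h * 2) ≡ 1
y^2*-diagonal zero    = refl
y^2*-diagonal (suc h) = trans (⊛-y² (y^2* h) (h * 2)) (y^2*-diagonal h)

y^2*-off : ∀ h k → k ≢ h * 2 → y^2* h k ≡ 0
y^2*-off zero    zero          k≢ = contradiction refl k≢
y^2*-off zero    (suc k)       k≢ = refl
y^2*-off (suc h) zero          k≢ = *-zeroʳ (y^2* h 0)
y^2*-off (suc h) (suc zero)    k≢ = ⊛-y²₁ (y^2* h)
y^2*-off (suc h) (suc (suc k)) k≢ = trans (⊛-y² (y^2* h) k) (y^2*-off h k (k≢ ∘ cong (suc ∘ suc)))

-- Σ_{k ≤ h} e_k y^{2k} (1 + N y)^{h-k}, that is Σ e_k t^{h-k} for t = x (x + N),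
-- reversed with respect to x = 1 / y.
homogenise : ℕ → Series → ℕ → Series
homogenise N e zero    = scalar (e 0)
homogenise N e (suc h) = homogenise N e h ⊛ lin N ⊕ scalar (e (suc h)) ⊛ y^2* (suc h)

-- The reversal of x² + N x + w = t + w.
quadratic : ℕ → ℕ → Series
quadratic N w = lin N ⊕ scalar w ⊛ y²

scalar-cong : ∀ {c d} → c ≡ d → scalar c ≗ scalar d
scalar-cong refl k = refl

scalar-lin-⊛ : ∀ e w k → scalar ((e ⊛ lin w) (suc k)) ≗ scalar (e (suc k)) ⊕ scalar w ⊛ scalar (e k)
scalar-lin-⊛ e w k = ≗-trans (scalar-cong (lin-⊛ w e k)) λ
  { zero → refl ; (suc i) → sym (trans (scalar-⊛ w (scalar (e k)) (suc i)) (*-zeroʳ w)) }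

homogenise-cong : ∀ N {e e′} h → e ≗ e′ → homogenise N e h ≗ homogenise N e′ h
homogenise-cong N zero    e≗ = scalar-cong (e≗ 0)
homogenise-cong N (suc h) e≗ = ⊕-cong (⊛-cong (homogenise-cong N h e≗) ≗-refl)
  (⊛-cong (scalar-cong (e≗ (suc h))) ≗-refl)

-- A factor 1 + w y in the generating function of the e_k becomes a factor t + w. The extra summand
-- is the term e_{h+1} which `homogenise N e h` cuts off.
homogenise-lin : ∀ N e w h → homogenise N (e ⊛ lin w) (suc h) ≗
  homogenise N e h ⊛ quadratic N w ⊕ scalar (e (suc h)) ⊛ y^2* (suc h)
homogenise-lin N e w zero = begin
  scalar ((e ⊛ lin w) 0) ⊛ lin N ⊕ scalar ((e ⊛ lin w) 1) ⊛ y^2* 1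
    ≈⟨ ⊕-cong (⊛-cong (scalar-cong (lin-⊛₀ w e)) ≗-refl) (⊛-cong (scalar-lin-⊛ e w 0) (⊛-identityˡ y²)) ⟩
  scalar (e 0) ⊛ lin N ⊕ (scalar (e 1) ⊕ scalar w ⊛ scalar (e 0)) ⊛ y²
    ≈⟨ homogenise-base (lin N) (scalar w) y² (scalar (e 0)) (scalar (e 1)) ⟩
  scalar (e 0) ⊛ quadratic N w ⊕ scalar (e 1) ⊛ y²
    ≈⟨ ⊕-cong ≗-refl (⊛-cong ≗-refl (⊛-identityˡ y²)) ⟨
  scalar (e 0) ⊛ quadratic N w ⊕ scalar (e 1) ⊛ y^2* 1 ∎
  where open SetoidReasoning ≗-setoid
homogenise-lin N e w (suc h) = begin
  homogenise N (e ⊛ lin w) (suc h) ⊛ lin N ⊕ scalar ((e ⊛ lin w) (suc (suc h))) ⊛ y^2* (suc (suc h))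
    ≈⟨ ⊕-cong (⊛-cong (homogenise-lin N e w h) ≗-refl) (⊛-cong (scalar-lin-⊛ e w (suc h)) ≗-refl) ⟩
  (homogenise N e h ⊛ quadratic N w ⊕ scalar (e (suc h)) ⊛ y^2* (suc h)) ⊛ lin N
    ⊕ (scalar (e (suc (suc h))) ⊕ scalar w ⊛ scalar (e (suc h))) ⊛ y^2* (suc (suc h))
    ≈⟨ homogenise-step (homogenise N e h) (lin N) (scalar w) y² (scalar (e (suc h))) (scalar (e (suc (suc h)))) (y^2* (suc h)) ⟩
  homogenise N e (suc h) ⊛ quadratic N w ⊕ scalar (e (suc (suc h))) ⊛ y^2* (suc (suc h)) ∎
  where open SetoidReasoning ≗-setoid

homogenise-Π : ∀ N e d (w : ℕ → ℕ) m → Degree≤ e d →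
  homogenise N (e ⊛ Π (λ z → lin (w z)) m) (m + d) ≗ homogenise N e d ⊛ Π (λ z → quadratic N (w z)) m
homogenise-Π N e d w zero    e≤d = ≗-trans (homogenise-cong N d (⊛-identityʳ e)) (≗-sym (⊛-identityʳ _))
homogenise-Π N e d w (suc m) e≤d = begin
  homogenise N (e ⊛ (Π (λ z → lin (w z)) m ⊛ lin (w m))) (suc (m + d))
    ≈⟨ homogenise-cong N (suc (m + d)) (≗-sym (⊛-assoc e (Π (λ z → lin (w z)) m) (lin (w m)))) ⟩
  homogenise N (e′ ⊛ lin (w m)) (suc (m + d))
    ≈⟨ homogenise-lin N e′ (w m) (m + d) ⟩
  homogenise N e′ (m + d) ⊛ quadratic N (w m) ⊕ scalar (e′ (suc (m + d))) ⊛ y^2* (suc (m + d))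
    ≈⟨ ⊕-cong (⊛-cong (homogenise-Π N e d w m e≤d) ≗-refl) vanish ⟩
  homogenise N e d ⊛ Π (λ z → quadratic N (w z)) m ⊛ quadratic N (w m) ⊕ const 0
    ≈⟨ (λ k → +-identityʳ _) ⟩
  homogenise N e d ⊛ Π (λ z → quadratic N (w z)) m ⊛ quadratic N (w m)
    ≈⟨ ⊛-assoc (homogenise N e d) _ _ ⟩
  homogenise N e d ⊛ Π (λ z → quadratic N (w z)) (suc m) ∎
  where
  open SetoidReasoning ≗-setoid
  e′ : Series
  e′ = e ⊛ Π (λ z → lin (w z)) m
  vanish : scalar (e′ (suc (m + d))) ⊛ y^2* (suc (m + d)) ≗ const 0
  vanish k = trans (scalar-⊛ _ (y^2* (suc (m + d))) k) (cong (_* y^2* (suc (m + d)) k)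
    (degree-⊛ {e} {Π (λ z → lin (w z)) m} e≤d (degree-Π w m) (suc (m + d)) (s≤s (≤-reflexive (+-comm d m)))))

lin-⊛-lin : ∀ u v → lin u ⊛ lin v ≗ quadratic (u + v) (u * v)
lin-⊛-lin u v k = trans (direct k) (cong (lin (u + v) k +_) (sym (scalar-⊛ (u * v) y² k)))
  where
  l₁ : ∀ u v → u + v * 1 ≡ u + v + u * v * 0
  l₁ = solve-∀
  l₂ : ∀ u v → v * u ≡ u * v * 1
  l₂ = solve-∀
  l₃ : ∀ u v → v * 0 ≡ u * v * 0
  l₃ = solve-∀
  direct : ∀ k → (lin u ⊛ lin v) k ≡ lin (u + v) k + u * v * y² k
  direct zero                = cong suc (sym (*-zeroʳ (u * v)))
  direct (suc zero)          = trans (lin-⊛ v (lin u) 0) (l₁ u v)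
  direct (suc (suc zero))    = trans (lin-⊛ v (lin u) 1) (l₂ u v)
  direct (suc (suc (suc k))) = trans (lin-⊛ v (lin u) (suc (suc k))) (l₃ u v)

-- The substitution of c y for y

scale-⊛ : ∀ c f g → scale c (f ⊛ g) ≗ scale c f ⊛ scale c g
scale-⊛ c f g zero    = lemma (f 0) (g 0)
  where
  lemma : ∀ x y → 1 * (x * y) ≡ 1 * x * (1 * y)
  lemma = solve-∀
scale-⊛ c f g (suc k) = trans (lemma c (c ^ k) (f 0) (g (suc k)) ((f ∘ suc ⊛ g) k))
  (cong (1 * f 0 * (c * c ^ k * g (suc k)) +_) (trans (cong (c *_) (scale-⊛ c (f ∘ suc) g k))
    (trans (sym (*-⊛ c (scale c (f ∘ suc)) (scale c g) k)) (⊛-cong (λ i → sym (*-assoc c (c ^ i) (f (suc i)))) ≗-refl k))))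
  where
  lemma : ∀ c p x y z → c * p * (x * y + z) ≡ 1 * x * (c * p * y) + c * (p * z)
  lemma = solve-∀

scale-scalar : ∀ c x → scale c (scalar x) ≗ scalar x
scale-scalar c x zero    = *-identityˡ x
scale-scalar c x (suc k) = *-zeroʳ (c ^ suc k)

scale-lin : ∀ c w → scale c (lin w) ≗ lin (c * w)
scale-lin c w zero          = refl
scale-lin c w (suc zero)    = cong (_* w) (*-identityʳ c)
scale-lin c w (suc (suc k)) = *-zeroʳ (c ^ suc (suc k))

scale-Π : ∀ c (w : ℕ → ℕ) m → scale c (Π (λ z → lin (w z)) m) ≗ Π (λ z → lin (c * w z)) m
scale-Π c w zero    = scale-scalar c 1
scale-Π c w (suc m) = ≗-trans (scale-⊛ c (Π (λ z → lin (w z)) m) (lin (w m))) (⊛-cong (scale-Π c w m) (scale-lin c (w m)))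

-- Putting 3 y for y turns 1 + N y into 1 + 3 N y and y^(2k) into 9^k y^(2k); hence the `scale 9` in
-- `D`.
scale-homogenise : ∀ N e h → scale 3 (homogenise N e h) ≗ homogenise (3 * N) (scale 9 e) h
scale-homogenise N e zero    = ≗-trans (scale-scalar 3 (e 0)) (scalar-cong (sym (*-identityˡ (e 0))))
scale-homogenise N e (suc h) k = trans (*-distribˡ-+ (3 ^ k) _ _) (cong₂ _+_
  (trans (scale-⊛ 3 (homogenise N e h) (lin N) k) (⊛-cong (scale-homogenise N e h) (scale-lin 3 N) k))
  (begin
    3 ^ k * (scalar x ⊛ y^2* (suc h)) k    ≡⟨ cong (3 ^ k *_) (scalar-⊛ x (y^2* (suc h)) k) ⟩
    3 ^ k * (x * y^2* (suc h) k)           ≡⟨ monomials ⟩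
    9 ^ suc h * x * y^2* (suc h) k         ≡⟨ scalar-⊛ (9 ^ suc h * x) (y^2* (suc h)) k ⟨
    (scalar (9 ^ suc h * x) ⊛ y^2* (suc h)) k ∎))
  where
  open ≡-Reasoning
  x : ℕ
  x = e (suc h)
  monomials : 3 ^ k * (x * y^2* (suc h) k) ≡ 9 ^ suc h * x * y^2* (suc h) k
  monomials with k ≟ suc h * 2
  ... | yes refl = trans (sym (*-assoc (3 ^ k) x _)) (cong (λ t → t * x * y^2* (suc h) k)
    (trans (cong (3 ^_) (*-comm (suc h) 2)) (sym (^-*-assoc 3 2 (suc h)))))
  ... | no k≢ rewrite y^2*-off (suc h) k k≢ = lemma (3 ^ k) x (9 ^ suc h)
    where
    lemma : ∀ p x q → p * (x * 0) ≡ q * x * 0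
    lemma = solve-∀

degree-homogenise : ∀ N e h → Degree≤ (homogenise N e h) (h * 2)
degree-homogenise N e zero    (suc k) _ = refl
degree-homogenise N e (suc h) k k> = cong₂ _+_
  (degree-⊛ {homogenise N e h} (degree-homogenise N e h) (degree-lin N) k (<-trans (≤-reflexive (cong suc (+-comm (h * 2) 1))) k>))
  (trans (scalar-⊛ (e (suc h)) (y^2* (suc h)) k)
    (trans (cong (e (suc h) *_) (y^2*-off (suc h) k λ k≡ → <-irrefl (sym k≡) k>)) (*-zeroʳ (e (suc h)))))

-- The rising factorial x (x + 1) ⋯ (x + N - 1), reversed by x = 1 / y.
rising : ℕ → Series
rising = Π lin

stirling₁-degree : ∀ N k → N < k → stirling₁ N k ≡ 0
stirling₁-degree zero    (suc k) _         = refl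
stirling₁-degree (suc N) (suc k) (s≤s N<k) = trans
  (cong₂ (λ x y → N * x + y) (stirling₁-degree N (suc k) (m<n⇒m<1+n N<k)) (stirling₁-degree N k N<k))
  (trans (+-identityʳ _) (*-zeroʳ N))

-- `lin-⊛` is the Stirling recurrence; the index is K = N - k because the polynomial is reversed.
rising-stirling₁ : ∀ N k K → k + K ≡ N → rising N k ≡ stirling₁ N K
rising-stirling₁ zero    zero    zero     _ = refl
rising-stirling₁ (suc N) zero    .(suc N) refl = begin
  (rising N ⊛ lin N) 0                  ≡⟨ lin-⊛₀ N (rising N) ⟩
  rising N 0                            ≡⟨ rising-stirling₁ N 0 N refl ⟩
  stirling₁ N N                         ≡⟨ cong (_+ stirling₁ N N) (trans (cong (N *_) (stirling₁-degree N (suc N) ≤-refl)) (*-zeroʳ N)) ⟨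
  stirling₁ (suc N) (suc N)             ∎
  where open ≡-Reasoning
rising-stirling₁ (suc N) (suc k) zero     e = begin
  (rising N ⊛ lin N) (suc k)            ≡⟨ lin-⊛ N (rising N) k ⟩
  rising N (suc k) + N * rising N k
    ≡⟨ cong₂ (λ x y → x + N * y) (degree-Π (λ z → z) N (suc k) (≤-reflexive (sym e′)))
         (rising-stirling₁ N k 0 (suc-injective e)) ⟩
  N * stirling₁ N 0                     ≡⟨ N*0 N ⟩
  0                                     ∎
  where
  open ≡-Reasoning
  e′ : suc k ≡ suc N
  e′ = trans (sym (+-identityʳ (suc k))) e
  N*0 : ∀ N → N * stirling₁ N 0 ≡ 0
  N*0 zero    = refl
  N*0 (suc N) = *-zeroʳ N
rising-stirling₁ (suc N) (suc k) (suc K) e = begin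
  (rising N ⊛ lin N) (suc k)                    ≡⟨ lin-⊛ N (rising N) k ⟩
  rising N (suc k) + N * rising N k
    ≡⟨ cong₂ (λ x y → x + N * y)
         (rising-stirling₁ N (suc k) K (trans (sym (+-suc k K)) (suc-injective e)))
         (rising-stirling₁ N k (suc K) (suc-injective e)) ⟩
  stirling₁ N K + N * stirling₁ N (suc K)       ≡⟨ +-comm (stirling₁ N K) _ ⟩
  stirling₁ (suc N) (suc K)                     ∎
  where open ≡-Reasoning

rising-thirds : ∀ m → rising (m * 3) ≗ scale 3 (rising m) ⊛ Π (λ z → quadratic (m * 3) (weight m z)) m
rising-thirds m = ≗-trans (Π-thirds lin m) (⊛-cong
  (≗-trans (Π-cong m λ z _ k → cong (λ t → lin t k) (*-comm z 3)) (≗-sym (scale-Π 3 (λ z → z) m)))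
  (Π-cong m λ z z<m → ≗-trans (lin-⊛-lin (1 + z * 3) (2 + (m ∸ suc z) * 3))
    λ k → cong (λ t → quadratic t (weight m z) k) (sum z (m ∸ suc z) (m+[n∸m]≡n z<m))))
  where
  sum : ∀ z r → suc z + r ≡ m → (1 + z * 3) + (2 + r * 3) ≡ m * 3
  sum z r refl = lemma z r
    where
    lemma : ∀ z r → (1 + z * 3) + (2 + r * 3) ≡ (suc z + r) * 3
    lemma = solve-∀

-- Exact valuations and parity

open import Data.Integer using (+_; _-_)
open import Data.Integer.Divisibility using (_∣_)

V3-≤ : ∀ {x y e f} → x ⊑ y → V3 x e → V3 y f → e ≤ f
V3-≤ {e = e} {f} x⊑y (3^e∣x , _) (_ , ∤y) with e ≤? f
... | yes e≤f = e≤f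
... | no  e≰f = contradiction (∣-trans (3^-mono-∣ (≰⇒> e≰f)) (x⊑y e 3^e∣x)) ∤y

parity : ∀ n → ∃ λ j → n ≡ j * 2 ⊎ n ≡ suc (j * 2)
parity zero    = 0 , inj₁ refl
parity (suc n) with parity n
... | j , inj₁ refl = j , inj₂ refl
... | j , inj₂ refl = suc j , inj₁ refl

-- Removing a successor from both numbers keeps the difference and lowers the sum by 2.
∣⊖⇒∣+ : ∀ m n → 2 ∣ℕ ℤ.∣ m ℤ.⊖ n ∣ → 2 ∣ℕ m + n
∣⊖⇒∣+ zero    zero    d = d
∣⊖⇒∣+ zero    (suc n) d = d
∣⊖⇒∣+ (suc m) zero    d = subst (2 ∣ℕ_) (sym (+-identityʳ (suc m))) d
∣⊖⇒∣+ (suc m) (suc n) d = subst (2 ∣ℕ_) (cong suc (sym (+-suc m n)))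
  (∣m∣n⇒∣m+n ∣-refl (∣⊖⇒∣+ m n (subst (λ i → 2 ∣ℕ ℤ.∣ i ∣) (ℤ.[1+m]⊖[1+n]≡m⊖n m n) d)))

∣+⇒∣⊖ : ∀ m n → 2 ∣ℕ m + n → 2 ∣ℕ ℤ.∣ m ℤ.⊖ n ∣
∣+⇒∣⊖ zero    zero    d = d
∣+⇒∣⊖ zero    (suc n) d = d
∣+⇒∣⊖ (suc m) zero    d = subst (2 ∣ℕ_) (+-identityʳ (suc m)) d
∣+⇒∣⊖ (suc m) (suc n) d = subst (λ i → 2 ∣ℕ ℤ.∣ i ∣) (sym (ℤ.[1+m]⊖[1+n]≡m⊖n m n))
  (∣+⇒∣⊖ m n (∣m+n∣m⇒∣n (subst (2 ∣ℕ_) (cong suc (+-suc m n)) d) ∣-refl))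

module Stirling (b : ℕ) (b<2 : b < 2) where
  private
    a : ℕ
    a = suc b
  open Roots a (s≤s z≤n) (s≤s b<2)

  -- The N factors of the rising factorial are h pairs, the factor x, and a - 1 middle factors.
  deg-M : ∀ s → deg s * 2 + a ≡ M s
  deg-M zero    = sym (*-identityʳ a)
  deg-M (suc s) = trans (lemma₁ (M s) (deg s) a) (trans (cong (λ t → M s * 2 + t) (deg-M s)) (lemma₂ a (3 ^ s)))
    where
    lemma₁ : ∀ m d a → (m + d) * 2 + a ≡ m * 2 + (d * 2 + a)
    lemma₁ = solve-∀
    lemma₂ : ∀ a p → a * p * 2 + a * p ≡ a * (3 * p)
    lemma₂ = solve-∀

  -- The factor (x + 3^s)^(a-1), reversed: for a = 2 the middle index N / 2 = 3^s has no partner.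
  -- The factor x itself reverses to 1.
  prefactor : ℕ → Series
  prefactor s = Π (λ _ → lin (3 ^ s)) b

  -- By `rising-thirds`, the multiples of 3 reproduce the formula for the previous s under y ↦ 3 y,
  -- and the remaining pairs multiply the generating function by W.
  rising-M : ∀ s → rising (M s) ≗ homogenise (M s) (D s) (deg s) ⊛ prefactor s
  rising-M zero = begin
    rising (a * 1)                 ≡⟨ cong rising (*-identityʳ a) ⟩
    rising a                       ≈⟨ small b b<2 ⟩
    prefactor 0                    ≈⟨ ⊛-identityˡ (prefactor 0) ⟨
    scalar 1 ⊛ prefactor 0         ∎
    where
    open SetoidReasoning ≗-setoid
    lin-0 : lin 0 ≗ scalar 1
    lin-0 zero          = refl
    lin-0 (suc zero)    = refl
    lin-0 (suc (suc k)) = refl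
    small : ∀ b → b < 2 → rising (suc b) ≗ Π (λ _ → lin 1) b
    small zero          _ = ≗-trans (⊛-identityˡ (lin 0)) lin-0
    small (suc zero)    _ = ⊛-cong (small zero (s≤s z≤n)) ≗-refl
    small (suc (suc b)) (s≤s (s≤s ()))
  rising-M (suc s) = begin
    rising (M (suc s))
      ≡⟨ cong rising M*3 ⟨
    rising (M s * 3)
      ≈⟨ rising-thirds (M s) ⟩
    scale 3 (rising (M s)) ⊛ T (M s * 3)
      ≈⟨ ⊛-cong (λ k → cong (3 ^ k *_) (rising-M s k)) ≗-refl ⟩
    scale 3 (homogenise (M s) (D s) (deg s) ⊛ prefactor s) ⊛ T (M s * 3)
      ≈⟨ ⊛-cong (≗-trans (scale-⊛ 3 (homogenise (M s) (D s) (deg s)) (prefactor s))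
           (⊛-cong (scale-homogenise (M s) (D s) (deg s)) (scale-Π 3 (λ _ → 3 ^ s) b))) ≗-refl ⟩
    homogenise (3 * M s) f (deg s) ⊛ prefactor (suc s) ⊛ T (M s * 3)
      ≡⟨ cong₂ (λ x y → homogenise x f (deg s) ⊛ prefactor (suc s) ⊛ T y) (trans (*-comm 3 (M s)) M*3) M*3 ⟩
    homogenise (M (suc s)) f (deg s) ⊛ prefactor (suc s) ⊛ T (M (suc s))
      ≈⟨ ⊛-assoc (homogenise (M (suc s)) f (deg s)) (prefactor (suc s)) (T (M (suc s))) ⟩
    homogenise (M (suc s)) f (deg s) ⊛ (prefactor (suc s) ⊛ T (M (suc s)))
      ≈⟨ ⊛-cong {homogenise (M (suc s)) f (deg s)} ≗-refl (⊛-comm (prefactor (suc s)) (T (M (suc s)))) ⟩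
    homogenise (M (suc s)) f (deg s) ⊛ (T (M (suc s)) ⊛ prefactor (suc s))
      ≈⟨ ⊛-assoc (homogenise (M (suc s)) f (deg s)) (T (M (suc s))) (prefactor (suc s)) ⟨
    homogenise (M (suc s)) f (deg s) ⊛ T (M (suc s)) ⊛ prefactor (suc s)
      ≈⟨ ⊛-cong (homogenise-Π (M (suc s)) f (deg s) (weight (M s)) (M s) (degree-scale 9 {D s} (degree-D s))) ≗-refl ⟨
    homogenise (M (suc s)) (D (suc s)) (deg (suc s)) ⊛ prefactor (suc s) ∎
    where
    open SetoidReasoning ≗-setoid
    f : Series
    f = scale 9 (D s)
    T : ℕ → Series
    T N = Π (λ z → quadratic N (weight (M s) z)) (M s)
    M*3 : M s * 3 ≡ M (suc s)
    M*3 = lemma a (3 ^ s)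
      where
      lemma : ∀ a p → a * p * 3 ≡ a * (3 * p)
      lemma = solve-∀

  module _ (s : ℕ) where
    open Valuations (valuations s)

    -- The property of the coefficients that survives both the factors 1 + N y and the new monomials
    -- in `homogenise`.
    record Controlled (h : ℕ) (f : Series) : Set where
      field
        even-⊑ : ∀ k → k ≤ h → f (k * 2) ⊑ D s k
        even-⊒ : ∀ k → k ≤ h → D s k ⊑ f (k * 2)
        odd-⊒  : ∀ k → k ≤ h → 3 ^ s * D s k ⊑ f (suc (k * 2))
    open Controlled

    -- D_{k+1} is dominated by 9 ^ s D_k, hence by 3 ^ s times the coefficient in between.
    even-dominates : ∀ {h f N} → 3 ^ s ∣ℕ N → h ≤ deg s → Controlled h f → ∀ k → suc k ≤ h →
      3 * f (suc k * 2) ⊑ N * f (suc (k * 2))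
    even-dominates {h} {f} {N} 3^s∣N h≤deg C k k<h =
      ⊑-trans (3*-mono-⊑ (even-⊑ C (suc k) k<h))
      (⊑-trans (downward k (<-≤-trans k<h h≤deg))
      (⊑-trans (⊑-reflexive square)
      (⊑-trans (3^-mono-⊑ s (odd-⊒ C k (<⇒≤ k<h)))
      (∣⇒⊑ (*-monoˡ-∣ (f (suc (k * 2))) 3^s∣N)))))
      where
      square : 9 ^ s * D s k ≡ 3 ^ s * (3 ^ s * D s k)
      square = trans (cong (_* D s k) (9^≡3^*3^ s)) (*-assoc (3 ^ s) (3 ^ s) (D s k))

    -- An even coefficient gains N times the preceding odd one, which it dominates; an odd one gains
    -- N times an even one, and 3^s divides N.
    controlled-lin : ∀ {h f N} → 3 ^ s ∣ℕ N → h ≤ deg s → Controlled h f → Controlled h (f ⊛ lin N)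
    controlled-lin {h} {f} {N} 3^s∣N h≤deg C = record
      { even-⊑ = λ
        { zero    k≤h → ⊑-trans (⊑-reflexive (lin-⊛₀ N f)) (even-⊑ C 0 k≤h)
        ; (suc k) k≤h → ⊑-trans (⊑-reflexive (lin-⊛ N f (suc (k * 2))))
            (⊑-trans (dominant-⊑ (even-dominates 3^s∣N h≤deg C k k≤h)) (even-⊑ C (suc k) k≤h)) }
      ; even-⊒ = λ
        { zero    k≤h → ⊑-trans (even-⊒ C 0 k≤h) (⊑-reflexive (sym (lin-⊛₀ N f)))
        ; (suc k) k≤h → ⊑-trans (even-⊒ C (suc k) k≤h) (⊑-trans (⊑-dominant (even-dominates 3^s∣N h≤deg C k k≤h))
            (⊑-reflexive (sym (lin-⊛ N f (suc (k * 2)))))) }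
      ; odd-⊒ = λ k k≤h w d → subst (3 ^ w ∣ℕ_) (sym (lin-⊛ N f (k * 2))) (∣m∣n⇒∣m+n (odd-⊒ C k k≤h w d)
          (∣⇒⊑ (*-monoˡ-∣ (f (k * 2)) 3^s∣N) w (3^-mono-⊑ s (even-⊒ C k k≤h) w d))) }

    controlled-≗ : ∀ {h f g} → f ≗ g → Controlled h f → Controlled h g
    controlled-≗ f≗g C = record
      { even-⊑ = λ k k≤h → ⊑-trans (⊑-reflexive (sym (f≗g (k * 2)))) (even-⊑ C k k≤h)
      ; even-⊒ = λ k k≤h → ⊑-trans (even-⊒ C k k≤h) (⊑-reflexive (f≗g (k * 2)))
      ; odd-⊒  = λ k k≤h → ⊑-trans (odd-⊒ C k k≤h) (⊑-reflexive (f≗g (suc (k * 2)))) }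

    controlled-homogenise : ∀ h → h ≤ deg s → Controlled h (homogenise (M s) (D s) h)
    controlled-homogenise zero    _     = record
      { even-⊑ = λ { zero _ → ⊑-reflexive refl }
      ; even-⊒ = λ { zero _ → ⊑-reflexive refl }
      ; odd-⊒  = λ { zero _ w _ → _ ∣0 } }
    controlled-homogenise (suc h) h<deg = record
      { even-⊑ = λ k k≤ → case k k≤ (λ k≤h → ⊑-trans (⊑-reflexive (agree (even≢ k≤h))) (even-⊑ C k k≤h))
                                    (λ { refl → ⊑-reflexive top })
      ; even-⊒ = λ k k≤ → case k k≤ (λ k≤h → ⊑-trans (even-⊒ C k k≤h) (⊑-reflexive (sym (agree (even≢ k≤h)))))
                                    (λ { refl → ⊑-reflexive (sym top) })
      ; odd-⊒  = λ k k≤ → case k k≤ (λ k≤h → ⊑-trans (odd-⊒ C k k≤h) (⊑-reflexive (sym (agree (odd≢ k≤h)))))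
                                    (λ { refl w _ → subst (3 ^ w ∣ℕ_) (sym beyond) (_ ∣0) }) }
      where
      H H′ : Series
      H  = homogenise (M s) (D s) h ⊛ lin (M s)
      H′ = homogenise (M s) (D s) (suc h)
      C : Controlled h H
      C = controlled-lin (n∣m*n a) (<⇒≤ h<deg) (controlled-homogenise h (<⇒≤ h<deg))
      case : ∀ {A : Set} k → k ≤ suc h → (k ≤ h → A) → (k ≡ suc h → A) → A
      case k k≤ small equal with m≤n⇒m<n∨m≡n k≤
      ... | inj₁ k<1+h = small (≤-pred k<1+h)
      ... | inj₂ k≡    = equal k≡
      even≢ : ∀ {k} → k ≤ h → k * 2 ≢ suc h * 2
      even≢ k≤h = <⇒≢ (*-monoˡ-< 2 (s≤s k≤h))
      odd≢ : ∀ {k} → k ≤ h → suc (k * 2) ≢ suc h * 2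
      odd≢ k≤h = <⇒≢ (s≤s (s≤s (*-monoˡ-≤ 2 k≤h)))
      agree : ∀ {i} → i ≢ suc h * 2 → H′ i ≡ H i
      agree {i} i≢ = trans (cong (λ t → H i + t) (trans (scalar-⊛ (D s (suc h)) (y^2* (suc h)) i)
        (trans (cong (D s (suc h) *_) (y^2*-off (suc h) i i≢)) (*-zeroʳ (D s (suc h)))))) (+-identityʳ (H i))
      -- `H` has degree at most 2 h + 1, so only the new monomial contributes here.
      top : H′ (suc h * 2) ≡ D s (suc h)
      top = cong₂ _+_
        (degree-⊛ {homogenise (M s) (D s) h} (degree-homogenise (M s) (D s) h) (degree-lin (M s)) (suc h * 2) (s≤s (≤-reflexive (+-comm (h * 2) 1))))
        (trans (scalar-⊛ (D s (suc h)) (y^2* (suc h)) (suc h * 2))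
          (trans (cong (D s (suc h) *_) (y^2*-diagonal (suc h))) (*-identityʳ (D s (suc h)))))
      beyond : H′ (suc (suc h * 2)) ≡ 0
      beyond = degree-homogenise (M s) (D s) (suc h) (suc (suc h * 2)) ≤-refl

    controlled-prefactor : ∀ {h f} c → h ≤ deg s → Controlled h f → Controlled h (f ⊛ Π (λ _ → lin (3 ^ s)) c)
    controlled-prefactor {f = f} zero    h≤deg C = controlled-≗ (≗-sym (⊛-identityʳ f)) C
    controlled-prefactor {f = f} (suc c) h≤deg C = controlled-≗ (⊛-assoc f (Π (λ _ → lin (3 ^ s)) c) (lin (3 ^ s)))
      (controlled-lin ∣-refl h≤deg (controlled-prefactor c h≤deg C))

    controlled-rising : Controlled (deg s) (rising (M s))
    controlled-rising = controlled-≗ (≗-sym (rising-M s)) (controlled-prefactor b ≤-refl (controlled-homogenise (deg s) ≤-refl))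

    -- The Stirling recurrence in the two parity classes

    private
      N : ℕ
      N = M s

    3^s∣N : 3 ^ s ∣ℕ N
    3^s∣N = n∣m*n a

    -- From k ≥ 1 and a ≤ 2, 2 j < N ≤ 2 h + 2.
    below-deg : ∀ {j k} → 1 ≤ k → j * 2 + k ≡ N → j ≤ deg s
    below-deg {j} {k} 1≤k e = ≤-pred (*-cancelʳ-< 2 j (suc (deg s)) (begin-strict
      j * 2             <⟨ m<m+n (j * 2) 1≤k ⟩
      j * 2 + k         ≡⟨ trans e (sym (deg-M s)) ⟩
      deg s * 2 + a     ≤⟨ +-monoʳ-≤ (deg s * 2) b<2 ⟩
      deg s * 2 + 2     ≡⟨ +-comm (deg s * 2) 2 ⟩
      suc (deg s) * 2   ∎))
      where open ≤-Reasoning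

    -- In s(N+1, k+1) = N s(N, k+1) + s(N, k) the last term dominates, being an even coefficient.
    even-case : ∀ j k → 1 ≤ k → j * 2 + k ≡ N → ∀ e f →
      V3 (stirling₁ (suc N) (suc k)) e → V3 (stirling₁ N k) f → e ≡ f
    even-case j k 1≤k j+k≡ e f Ve Vf = ≤-antisym (V3-≤ below Ve Vf) (V3-≤ above Vf Ve)
      where
      x z : ℕ
      x = stirling₁ N k
      z = N * stirling₁ N (suc k)
      dominates : ∀ j → j * 2 + k ≡ N → 3 * x ⊑ z
      -- Here k = N, and s(N, N+1) = 0.
      dominates zero    refl w _ = subst (3 ^ w ∣ℕ_)
        (sym (trans (cong (N *_) (stirling₁-degree N (suc k) ≤-refl)) (*-zeroʳ N))) (_ ∣0)
      dominates (suc j) j+k≡ =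
        ⊑-trans (⊑-reflexive (cong (3 *_) (sym (rising-stirling₁ N (suc j * 2) k j+k≡))))
        (⊑-trans (even-dominates 3^s∣N ≤-refl controlled-rising j (below-deg 1≤k j+k≡))
        (⊑-reflexive (cong (N *_) (rising-stirling₁ N (suc (j * 2)) (suc k) (trans (+-suc (suc (j * 2)) k) j+k≡)))))
      below : z + x ⊑ x
      below = ⊑-trans (⊑-reflexive (+-comm z x)) (dominant-⊑ (dominates j j+k≡))
      above : x ⊑ z + x
      above = ⊑-trans (⊑-dominant (dominates j j+k≡)) (⊑-reflexive (+-comm x z))

    -- Both terms of the recurrence have at least s more factors 3 than s(N, k+1): one through 3^s ∣
    -- N, the other as the odd coefficient next to the even coefficient s(N, k+1).
    odd-case : ∀ j k → 1 ≤ k → suc (j * 2) + k ≡ N → ∀ e f →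
      V3 (stirling₁ (suc N) (suc k)) e → V3 (stirling₁ N (suc k)) f → e ≥ f + s
    odd-case j k 1≤k j+k≡ e f (_ , ∤e) (3^f∣ , _) with f + s ≤? e
    ... | yes f+s≤e = f+s≤e
    ... | no  f+s≰e = contradiction (∣-trans (3^-mono-∣ (≰⇒> f+s≰e)) (∣m∣n⇒∣m+n
        (∣-trans divides-3^s*y (*-monoˡ-∣ y 3^s∣N))
        (subst (3 ^ (f + s) ∣ℕ_) (rising-stirling₁ N (suc (j * 2)) k j+k≡)
          (odd-⊒ controlled-rising j j≤deg (f + s)
            (3^-mono-⊑ s (even-⊑ controlled-rising j j≤deg) (f + s)
              (subst (λ t → 3 ^ (f + s) ∣ℕ 3 ^ s * t) (sym (rising-stirling₁ N (j * 2) (suc k) j+1+k≡)) divides-3^s*y)))))) ∤e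
      where
      y : ℕ
      y = stirling₁ N (suc k)
      j+1+k≡ : j * 2 + suc k ≡ N
      j+1+k≡ = trans (+-suc (j * 2) k) j+k≡
      j≤deg : j ≤ deg s
      j≤deg = below-deg (s≤s z≤n) j+1+k≡
      divides-3^s*y : 3 ^ (f + s) ∣ℕ 3 ^ s * y
      divides-3^s*y = subst (_∣ℕ 3 ^ s * y) (trans (sym (^-distribˡ-+-* 3 s f)) (cong (3 ^_) (+-comm s f))) (*-monoʳ-∣ (3 ^ s) 3^f∣)

    -- By `deg-M`, N and a have the same parity, hence so do N - k and k - a.
    parity-even : ∀ j k → j * 2 + k ≡ N → (+ 2) ∣ (+ k - + a)
    parity-even j k e = subst (2 ∣ℕ_) (cong ℤ.∣_∣ (sym (ℤ.m-n≡m⊖n k a))) (∣+⇒∣⊖ k a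
      (∣m+n∣m⇒∣n (subst (2 ∣ℕ_) (sum-even j k e) (n∣m*n (deg s + a))) (n∣m*n j)))
      where
      sum-even : ∀ j k → j * 2 + k ≡ N → (deg s + a) * 2 ≡ j * 2 + (k + a)
      sum-even j k e = trans (lemma (deg s) a) (trans (cong (_+ a) (trans (deg-M s) (sym e))) (+-assoc (j * 2) k a))
        where
        lemma : ∀ d a → (d + a) * 2 ≡ d * 2 + a + a
        lemma = solve-∀

    parity-odd : ∀ j k → suc (j * 2) + k ≡ N → ¬ (+ 2) ∣ (+ k - + a)
    parity-odd j k e d = >⇒∤ (s≤s (s≤s z≤n)) (∣m+n∣m⇒∣n (subst (2 ∣ℕ_) sum-odd (n∣m*n (deg s + a)))
      (∣m∣n⇒∣m+n (n∣m*n j) (∣⊖⇒∣+ k a (subst (2 ∣ℕ_) (cong ℤ.∣_∣ (ℤ.m-n≡m⊖n k a)) d))))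
      where
      lemma : ∀ d a → (d + a) * 2 ≡ d * 2 + a + a
      lemma = solve-∀
      lemma′ : ∀ j k a → suc j + k + a ≡ j + (k + a) + 1
      lemma′ = solve-∀
      sum-odd : (deg s + a) * 2 ≡ j * 2 + (k + a) + 1
      sum-odd = trans (lemma (deg s) a) (trans (cong (_+ a) (trans (deg-M s) (sym e))) (lemma′ (j * 2) k a))

    v₃-recurrence : ∀ k → 1 ≤ k → k ≤ N →
      ((+ 2) ∣ (+ k - + a) → ∀ e f → V3 (stirling₁ (suc N) (suc k)) e → V3 (stirling₁ N k) f → e ≡ f)
      × (¬ ((+ 2) ∣ (+ k - + a)) → ∀ e f → V3 (stirling₁ (suc N) (suc k)) e → V3 (stirling₁ N (suc k)) f → e ≥ f + s)
    v₃-recurrence k 1≤k k≤N with parity (N ∸ k)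
    ... | j , inj₁ N∸k≡ = (λ _ → even-case j k 1≤k e) , λ odd → contradiction (parity-even j k e) odd
      where
      e : j * 2 + k ≡ N
      e = trans (cong (_+ k) (sym N∸k≡)) (m∸n+n≡m k≤N)
    ... | j , inj₂ N∸k≡ = (λ even → contradiction even (parity-odd j k e)) , λ _ → odd-case j k 1≤k e
      where
      e : suc (j * 2) + k ≡ N
      e = trans (cong (_+ k) (sym N∸k≡)) (m∸n+n≡m k≤N)

theorem1p3 : (a n k : ℕ) → (a ≡ 1 ⊎ a ≡ 2) → 1 ≤ n → 1 ≤ k → k ≤ a * 3 ^ n →
    ((+ 2) ∣ (+ k - + a) →
    ∀ e f → V3 (stirling₁ (suc (a * 3 ^ n)) (suc k)) e →
    V3 (stirling₁ (a * 3 ^ n) k) f → e ≡ f)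
    × (¬ ((+ 2) ∣ (+ k - + a)) →
    ∀ e f → V3 (stirling₁ (suc (a * 3 ^ n)) (suc k)) e →
    V3 (stirling₁ (a * 3 ^ n) (suc k)) f → e ≥ f + n)
theorem1p3 .1 n k (inj₁ refl) _ 1≤k k≤N = Stirling.v₃-recurrence 0 (s≤s z≤n) n k 1≤k k≤N
theorem1p3 .2 n k (inj₂ refl) _ 1≤k k≤N = Stirling.v₃-recurrence 1 (s≤s (s≤s z≤n)) n k 1≤k k≤N
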